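{- Let $d \ge 1$ be an integer and let $G$ be a finite graph of girth $6$ with fractional chromatic number $\chi_f(G) \ge 8.1d$. Let $p = |V(G)|$, let $q$ be an integer with $q \ge 2^{p-1}p^2$, and let $c = 4q+2$. Then $\chi(G[K_q]) \ge 2dc - 2c + 2$ and $\chi\big(K_{dc}^{G[K_q]}\big) \ge 2dc - 2c + 2$. Consequently, $f(2dc-2c+2) \le dc$, where $f$ is the Poljak–Rödl function.
   Context: All graphs are finite. For a graph $G$ and a positive integer $q$, $G[K_q]$ denotes the graph obtained by blowing up each vertex of $G$ into a $q$-clique: its vertex set is $V(G)\times[q]$ (where $[q]=\{1,\dots,q\}$), and $(x,i)$ is adjacent to $(y,j)$ if and only if either $xy \in E(G)$, or $x=y$ and $i\ne j$. For a positive integer $m$ and a graph $H$, the exponential graph $K_m^H$ has as vertices all maps $\phi: V(H)\to[m]$, with $\phi$ adjacent to $\psi$ if and only if $\phi(x)\ne\psi(y)$ for every edge $xy\in E(H)$ (so $\phi$ has a loop exactly when it is a proper $m$-colouring of $H$). The product $G\times H$ of graphs has vertex set $V(G)\times V(H)$, with $(x,y)$ adjacent to $(x',y')$ if and only if $xx'\in E(G)$ and $yy'\in E(H)$. The Poljak–Rödl function is $f(n)=\min\{\chi(G\times H): \chi(G)\ge n,\ \chi(H)\ge n\}$. -}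

module Defs where

open import Data.Nat using (ℕ; zero; suc; _+_; _*_; _∸_; _^_; _≤_; _<_)
open import Data.Fin using (Fin; inject₁; fromℕ) renaming (zero to fzero; suc to fsuc)
open import Data.Fin.Subset using (Subset; ∣_∣; _∈_)
open import Data.Product using (Σ; ∃; _×_; _,_; proj₁; proj₂)
open import Data.Sum using (_⊎_; inj₁; inj₂)
open import Relation.Nullary using (¬_)
open import Data.Empty using (⊥)
open import Relation.Binary.PropositionalEquality using (_≡_; _≢_; refl) renaming (sym to ≡-sym)
open import Function.Definitions using (Injective)

-- A graph on a (finite) vertex type V: a symmetric adjacency relation.
-- Loops are allowed in general (the exponential graph may have loops).
record Graph (V : Set) : Set₁ where
  field
    E   : V → V → Set
    E-sym : ∀ {x y} → E x y → E y x
open Graph public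

Loopless : ∀ {V} → Graph V → Set
Loopless {V} G = ∀ (x : V) → ¬ E G x x

Blowup : ∀ {V} → Graph V → (q : ℕ) → Graph (V × Fin q)
Blowup G q = record
  { E   = λ { (x , i) (y , j) → E G x y ⊎ (x ≡ y × i ≢ j) }
  ; E-sym = λ { (inj₁ e) → inj₁ (E-sym G e)
            ; (inj₂ (refl , i≢j)) → inj₂ (refl , λ eq → i≢j (≡-sym eq)) } }

Exp : (m : ℕ) → ∀ {V} → Graph V → Graph (V → Fin m)
Exp m H = record
  { E   = λ φ ψ → ∀ x y → E H x y → φ x ≢ ψ y
  ; E-sym = λ adj x y e eq → adj y x (E-sym H e) (≡-sym eq) }

Prod : ∀ {V W} → Graph V → Graph W → Graph (V × W)
Prod G H = record
  { E   = λ { (x , y) (x' , y') → E G x x' × E H y y' }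
  ; E-sym = λ { (e₁ , e₂) → E-sym G e₁ , E-sym H e₂ } }

Colouring : ∀ {V} → Graph V → ℕ → Set
Colouring {V} G k = Σ (V → Fin k) λ c → ∀ x y → E G x y → c x ≢ c y

-- χ(G) ≥ n : every proper colouring uses at least n colours
-- (vacuously true if no proper colouring exists, i.e. χ = ∞).
ChromGe : ∀ {V} → Graph V → ℕ → Set
ChromGe G n = ∀ k → Colouring G k → n ≤ k

ABColouring : ∀ {V} → Graph V → ℕ → ℕ → Set
ABColouring {V} G a b =
  Σ (V → Subset a) λ c → (∀ x → ∣ c x ∣ ≡ b) ×
    (∀ x y → E G x y → ∀ i → ¬ (i ∈ c x × i ∈ c y))

-- χ_f(G) ≥ num/den, with χ_f(G) = inf { a/b : G has an a:b-colouring, b ≥ 1 }.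
FracChromGe : ∀ {V} → Graph V → (num den : ℕ) → Set
FracChromGe G num den = ∀ a b → 1 ≤ b → ABColouring G a b → num * b ≤ den * a

HasCycle : ∀ {V} → Graph V → ℕ → Set
HasCycle G zero = ⊥
HasCycle {V} G (suc k) =
  Σ (Fin (suc k) → V) λ f → Injective _≡_ _≡_ f ×
    ((∀ (i : Fin k) → E G (f (inject₁ i)) (f (fsuc i))) × E G (f (fromℕ k)) (f fzero))

Girth : ∀ {V} → Graph V → ℕ → Set
Girth G g = HasCycle G g × (∀ ℓ → 3 ≤ ℓ → ℓ < g → ¬ HasCycle G ℓ)

-- f(n) ≤ m for the Poljak–Rödl function f(n) = min{χ(G×H) : χ(G), χ(H) ≥ n}
-- over finite (loopless) graphs.
PoljakRodlLe : ℕ → ℕ → Set₁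
PoljakRodlLe n m =
  Σ ℕ λ a → Σ ℕ λ b → Σ (Graph (Fin a)) λ G → Σ (Graph (Fin b)) λ H →
    Loopless G × Loopless H × ChromGe G n × ChromGe H n × Colouring (Prod G H) m

{-# OPTIONS --safe #-}
module Submission where

-- Let m = d c and H = G[K_q]. The colour sets of the q-cliques turn a colouring of H into a
-- fractional colouring of G, which bounds χ(H). In a colouring Ψ of K_m^H the m constant maps get
-- distinct "primary" colours, and a map with a primary colour i must take the value i.
-- Shitov's argument shows that for every set A of at least c colours some map into A gets a
-- secondary colour. Maps into disjoint sets are adjacent, so this is a proper colouring of the
-- Kneser graph KG(m , c) by the secondary colours, and the Lovász–Kneser theorem gives at least
-- m - 2c + 2 of them. That theorem is deduced from Tucker's lemma for the barycentric subdivision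
-- of the cross-polytope, which is proved by Fan's parity count of alternating chains.
-- Since the edge relation of G need not be decidable, contradictions are derived under a double
-- negation, which is harmless for finitely many instances of excluded middle.

open import Defs
open import Data.Nat using (ℕ; zero; suc; _+_; _*_; _∸_; _^_; _≤_; _<_; z≤n; s≤s; _<?_; _≤?_)
open import Data.Nat.Properties using (≤-refl; ≤-trans; ≤-reflexive; ≰⇒>; ≮⇒≥; ≤-pred; ≤-<-trans; <-irrefl; <-asym; <-cmp; <⇒≤; <⇒≱; n≤0⇒n≡0; n<1⇒n≡0; m≤n⇒m≤1+n; suc-injective; +-suc; +-identityʳ; +-mono-≤; +-monoˡ-≤; +-cancelˡ-<; m≤m+n; m≤n+m; *-comm; *-assoc; *-zeroʳ; *-identityʳ; *-mono-≤; *-monoˡ-≤; *-monoʳ-≤; *-monoʳ-<; *-cancelˡ-≤; *-cancelˡ-<; m*n≢0; m^n≢0; m^n>0; ^-monoˡ-≤; ^-monoʳ-≤; n∸n≡0; m+n∸m≡n; m+n∸n≡m; ∸-monoˡ-≤; ∸-monoʳ-≤; +-*-semiring; module ≤-Reasoning)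
open import Data.Nat.Tactic.RingSolver using (solve-∀)
open import Algebra.Properties.Semiring.Sum +-*-semiring using (sum; sum-cong-≗; ∑-comm; *-distribˡ-sum)
open import Data.Bool using (Bool; true; false; _xor_; if_then_else_)
open import Data.Bool.Properties using (xor-same; xor-identityʳ; xor-comm; xor-assoc)
open import Data.Bool.Solver using (module xor-∧-Solver)
open import Data.Sign using (Sign; opposite) renaming (+ to ⊕; - to ⊖)
open import Data.Sign.Properties using (s≢opposite[s])
open import Data.Maybe as Maybe using (Maybe; just; nothing; Is-just)
open import Data.Maybe.Properties using (just-injective)
import Data.Maybe.Relation.Unary.Any as MAny
open import Data.Fin using (Fin; _≟_; toℕ; fromℕ<; _↑ˡ_; _↑ʳ_; splitAt; inject≤; punchOut; remQuot; combine; finToFun; funToFin) renaming (zero to fzero; suc to fsuc)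
open import Data.Fin.Properties using (any?; all?; ∀-cons; ¬∀⟶∃¬; pigeonhole; injective⇒≤; inject≤-injective; punchOut-injective; toℕ-injective; toℕ-fromℕ<; fromℕ<-cong; splitAt-↑ˡ; splitAt-↑ʳ; ↑ˡ-injective; ↑ʳ-injective; <⇒≢; remQuot-combine; finToFun-funToFin) renaming (suc-injective to fsuc-injective)
open import Data.Fin.Subset using (Subset; ∣_∣; _∈_; ∁; inside; outside) renaming (⊥ to ∅)
open import Data.Fin.Subset.Properties using (∣⊥∣≡0; ∉⊥; ∣∁p∣≡n∸∣p∣; x∈∁p⇒x∉p)
open import Data.List as List using (List; []; _∷_; length)
open import Data.List.Relation.Unary.All as All using (All; []; _∷_)
open import Data.List.Relation.Unary.AllPairs using (AllPairs; []; _∷_)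
open import Data.Vec as Vec using (Vec; []; _∷_; here; there; lookup; tabulate; _[_]≔_)
open import Data.Vec.Properties using ([]≔-updates; []≔-minimal; lookup∘update′; lookup∘tabulate; []=⇒lookup; lookup⇒[]=)
import Data.Vec.Functional as Vector
import Data.Vec.Relation.Unary.Any as Any
open import Data.Vec.Relation.Unary.All using ([]; _∷_)
open import Data.Vec.Relation.Unary.AllPairs using ([]; _∷_)
open import Data.Vec.Relation.Unary.Unique.Propositional using (Unique)
open import Data.Vec.Relation.Unary.Unique.Propositional.Properties using (lookup-injective)
open import Data.Vec.Relation.Binary.Pointwise.Inductive as PW using (Pointwise; []; _∷_)
open import Data.Sum using (_⊎_; inj₁; inj₂; [_,_]′)
open import Data.Product using (Σ; ∃; _×_; _,_; proj₁; proj₂)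
open import Data.Empty using (⊥; ⊥-elim)
open import Data.Unit using (tt)
open import Function using (_∘_; const)
open import Function.Definitions using (Injective)
open import Relation.Nullary using (¬_; Dec; yes; no; does; contradiction)
open import Relation.Nullary.Decidable using (¬¬-excluded-middle; _⊎-dec_; _×-dec_)
open import Relation.Binary using (tri<; tri≈; tri>)
open import Relation.Binary.PropositionalEquality

-- Finite choice under double negation, subsets, and ranks.

¬¬-∀-Fin : ∀ {n} {P : Fin n → Set} → (∀ i → ¬ ¬ P i) → ¬ ¬ (∀ i → P i)
¬¬-∀-Fin {zero}  h k = k λ ()
¬¬-∀-Fin {suc n} h k = h fzero λ p → ¬¬-∀-Fin (h ∘ fsuc) λ ps → k (∀-cons p ps)

-- With an existential for `P` this serves as finite choice: one witness per subset is available
-- while deriving a contradiction.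
¬¬-∀-Subset : ∀ {n} {P : Subset n → Set} → (∀ A → ¬ ¬ P A) → ¬ ¬ (∀ A → P A)
¬¬-∀-Subset {zero}  h k = h [] λ p → k λ { [] → p }
¬¬-∀-Subset {suc n} h k =
  ¬¬-∀-Subset (h ∘ (outside ∷_)) λ ps →
  ¬¬-∀-Subset (h ∘ (inside ∷_)) λ qs →
  k λ { (outside ∷ A) → ps A ; (inside ∷ A) → qs A }

enumerate : ∀ {n} (A : Subset n) k → k ≤ ∣ A ∣ →
  ∃ λ (α : Fin k → Fin n) → Injective _≡_ _≡_ α × ∀ i → α i ∈ A
enumerate A             zero    _ = (λ ()) , (λ { {()} }) , λ ()
enumerate (outside ∷ A) (suc k) h with enumerate A (suc k) h
... | α , inj , α∈A = fsuc ∘ α , inj ∘ fsuc-injective , there ∘ α∈A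
enumerate (inside ∷ A)  (suc k) (s≤s h) with enumerate A k h
... | α , inj , α∈A = α′ , (λ {i} {j} → inj′ i j) , α′∈A
  where
  α′ : Fin (suc k) → Fin _
  α′ fzero    = fzero
  α′ (fsuc i) = fsuc (α i)
  inj′ : ∀ i j → α′ i ≡ α′ j → i ≡ j
  inj′ fzero    fzero    _ = refl
  inj′ (fsuc i) (fsuc j) e = cong fsuc (inj (fsuc-injective e))
  α′∈A : ∀ i → α′ i ∈ (inside ∷ A)
  α′∈A fzero    = here
  α′∈A (fsuc i) = there (α∈A i)

image : ∀ {q k} → (Fin q → Fin k) → Subset k
image {zero}  f = ∅
image {suc q} f = image (f ∘ fsuc) [ f fzero ]≔ inside

∈-image⁺ : ∀ {q k} (f : Fin q → Fin k) i → f i ∈ image f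
∈-image⁺ f fzero    = []≔-updates (image (f ∘ fsuc)) (f fzero)
∈-image⁺ f (fsuc i) with f fzero ≟ f (fsuc i)
... | yes e = subst (_∈ image f) e ([]≔-updates (image (f ∘ fsuc)) (f fzero))
... | no ≢  = []≔-minimal (image (f ∘ fsuc)) (f (fsuc i)) (f fzero) (≢ ∘ sym) (∈-image⁺ (f ∘ fsuc) i)

∈-image⁻ : ∀ {q k} (f : Fin q → Fin k) {j} → j ∈ image f → ∃ λ i → f i ≡ j
∈-image⁻ {zero}  f j∈ = ⊥-elim (∉⊥ j∈)
∈-image⁻ {suc q} f {j} j∈ with f fzero ≟ j
... | yes e = fzero , e
... | no ≢ with ∈-image⁻ (f ∘ fsuc) {j} (lookup⇒[]= j _
                 (trans (sym (lookup∘update′ (≢ ∘ sym) (image (f ∘ fsuc)) inside)) ([]=⇒lookup j∈)))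
...   | i , e = fsuc i , e

∣insert∣ : ∀ {n} (A : Subset n) i → ¬ i ∈ A → ∣ A [ i ]≔ inside ∣ ≡ suc ∣ A ∣
∣insert∣ (outside ∷ A) fzero    i∉A = refl
∣insert∣ (inside ∷ A)  fzero    i∉A = ⊥-elim (i∉A here)
∣insert∣ (outside ∷ A) (fsuc i) i∉A = ∣insert∣ A i (i∉A ∘ there)
∣insert∣ (inside ∷ A)  (fsuc i) i∉A = cong suc (∣insert∣ A i (i∉A ∘ there))

∣image∣ : ∀ {q k} (f : Fin q → Fin k) → Injective _≡_ _≡_ f → ∣ image f ∣ ≡ q
∣image∣ {zero}  {k} f inj = ∣⊥∣≡0 k
∣image∣ {suc q} f inj = trans (∣insert∣ _ _ new) (cong suc (∣image∣ (f ∘ fsuc) (fsuc-injective ∘ inj)))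
  where
  new : ¬ f fzero ∈ image (f ∘ fsuc)
  new j∈ with ∈-image⁻ (f ∘ fsuc) j∈
  ... | i , e with inj e
  ...   | ()

-- Numbers the points outside the image of `ι` by punching out its values one at a time. Later `ι`
-- lists the primary colours, and the rank names the secondary ones.
co-rank : ∀ {a b} (ι : Fin a → Fin (a + b)) → Injective _≡_ _≡_ ι →
  Σ (∀ y → (∀ i → ι i ≢ y) → Fin b) λ rank → ∀ y z ny nz → rank y ny ≡ rank z nz → y ≡ z
co-rank {zero}  ι inj = (λ y _ → y) , λ _ _ _ _ e → e
co-rank {suc a} {b} ι inj = (λ y ny → proj₁ rec (punchOut (ny fzero)) (away y ny))
  , λ y z ny nz e → punchOut-injective (ny fzero) (nz fzero) (proj₂ rec _ _ (away y ny) (away z nz) e)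
  where
  ne : ∀ i → ι fzero ≢ ι (fsuc i)
  ne i e with inj e
  ... | ()
  rec = co-rank {a} {b} (λ i → punchOut (ne i)) λ {i} {j} e → fsuc-injective (inj (punchOut-injective (ne i) (ne j) e))
  away : ∀ y (ny : ∀ i → ι i ≢ y) i → punchOut (ne i) ≢ punchOut (ny fzero)
  away y ny i e = ny (fsuc i) (punchOut-injective (ne i) (ny fzero) e)

module _ {n} {P : Fin n → Set} (P? : ∀ i → Dec (P i)) where

  select : Subset n
  select = tabulate λ i → does (P? i)

  ∈-select⁻ : ∀ {i} → i ∈ select → P i
  ∈-select⁻ {i} i∈ with P? i | trans (sym (lookup∘tabulate (λ i → does (P? i)) i)) ([]=⇒lookup i∈)
  ... | yes p | _ = p

  ∈-select⁺ : ∀ {i} → P i → i ∈ select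
  ∈-select⁺ {i} p with P? i in eq
  ... | yes _ = lookup⇒[]= i _ (trans (lookup∘tabulate (λ i → does (P? i)) i) (cong does eq))
  ... | no ¬p = ⊥-elim (¬p p)

-- The octahedral Tucker lemma

-- Faces of the cross-polytope: `nothing` is the entry 0, the zero vector is the empty face, and
-- `_⊑_` below is inclusion of faces.
SignVec : ℕ → Set
SignVec n = Vec (Maybe Sign) n

data _≼_ : Maybe Sign → Maybe Sign → Set where
  nothing≼ : ∀ {y} → nothing ≼ y
  ≼-refl   : ∀ {x} → x ≼ x

≼-trans : ∀ {x y z} → x ≼ y → y ≼ z → x ≼ z
≼-trans nothing≼ _ = nothing≼
≼-trans ≼-refl   q = q

_⊑_ : ∀ {n} → SignVec n → SignVec n → Set
_⊑_ = Pointwise _≼_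

⊑-refl : ∀ {n} {X : SignVec n} → X ⊑ X
⊑-refl = PW.refl ≼-refl

⊑-trans : ∀ {n} {X Y Z : SignVec n} → X ⊑ Y → Y ⊑ Z → X ⊑ Z
⊑-trans = PW.trans ≼-trans

NonZero : ∀ {n} → SignVec n → Set
NonZero = Any.Any Is-just

neg : ∀ {n} → SignVec n → SignVec n
neg = Vec.map (Maybe.map opposite)

-- The facets of X are the vectors obtained from X by deleting one sign; ∂ sums g over them mod 2.
∂ : ∀ {n} → (SignVec n → Bool) → SignVec n → Bool
∂ g []            = false
∂ g (nothing ∷ X) = ∂ (λ Y → g (nothing ∷ Y)) X
∂ g (just s ∷ X)  = g (nothing ∷ X) xor ∂ (λ Y → g (just s ∷ Y)) X

-- Having a facet forces `X` to be nonzero, and facets lie below `X`. Passing both facts on lets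
-- chain arguments use hypotheses about nonzero comparable vectors.
∂-cong : ∀ {n} (X : SignVec n) {g h} → (NonZero X → ∀ Y → Y ⊑ X → g Y ≡ h Y) → ∂ g X ≡ ∂ h X
∂-cong []            e = refl
∂-cong (nothing ∷ X) e = ∂-cong X λ nz Y Y⊑X → e (Any.there nz) (nothing ∷ Y) (≼-refl ∷ Y⊑X)
∂-cong (just s ∷ X)  e = cong₂ _xor_
  (e (Any.here (MAny.just tt)) (nothing ∷ X) (nothing≼ ∷ ⊑-refl))
  (∂-cong X λ nz Y Y⊑X → e (Any.here (MAny.just tt)) (just s ∷ Y) (≼-refl ∷ Y⊑X))

xor-interchange : ∀ a b c d → (a xor b) xor (c xor d) ≡ (a xor c) xor (b xor d)
xor-interchange = solve 4 (λ a b c d → (a :+ b) :+ (c :+ d) := (a :+ c) :+ (b :+ d)) refl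
  where open xor-∧-Solver

∂-xor : ∀ {n} (X : SignVec n) g h → ∂ (λ Y → g Y xor h Y) X ≡ ∂ g X xor ∂ h X
∂-xor []            g h = refl
∂-xor (nothing ∷ X) g h = ∂-xor X _ _
∂-xor (just s ∷ X)  g h =
  trans (cong ((g (nothing ∷ X) xor h (nothing ∷ X)) xor_) (∂-xor X (λ Y → g (just s ∷ Y)) (λ Y → h (just s ∷ Y))))
        (xor-interchange (g (nothing ∷ X)) (h (nothing ∷ X))
          (∂ (λ Y → g (just s ∷ Y)) X) (∂ (λ Y → h (just s ∷ Y)) X))

∂-false : ∀ {n} (X : SignVec n) → ∂ (λ _ → false) X ≡ false
∂-false []            = refl
∂-false (nothing ∷ X) = ∂-false X
∂-false (just s ∷ X)  = ∂-false X

-- Deleting two signs in either order gives the same vector, so the terms cancel in pairs.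
∂∂ : ∀ {n} (X : SignVec n) g → ∂ (∂ g) X ≡ false
∂∂ []            g = refl
∂∂ (nothing ∷ X) g = ∂∂ X _
∂∂ (just s ∷ X)  g = begin
  a xor ∂ (λ Y → g (nothing ∷ Y) xor ∂ (λ Z → g (just s ∷ Z)) Y) X
    ≡⟨ cong (a xor_) (∂-xor X _ _) ⟩
  a xor (a xor ∂ (∂ (λ Z → g (just s ∷ Z))) X)
    ≡⟨ cong (λ b → a xor (a xor b)) (∂∂ X _) ⟩
  a xor (a xor false)
    ≡⟨ cong (a xor_) (xor-identityʳ a) ⟩
  a xor a
    ≡⟨ xor-same a ⟩
  false ∎
  where open ≡-Reasoning
        a = ∂ (λ Y → g (nothing ∷ Y)) X

∂-neg : ∀ {n} (X : SignVec n) g → ∂ g (neg X) ≡ ∂ (λ Y → g (neg Y)) X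
∂-neg []            g = refl
∂-neg (nothing ∷ X) g = ∂-neg X _
∂-neg (just s ∷ X)  g = cong (g (nothing ∷ neg X) xor_) (∂-neg X (λ Y → g (just (opposite s) ∷ Y)))

∑± : ∀ {n} → (SignVec n → Bool) → Bool
∑± {zero}  g = g []
∑± {suc n} g = ∑± (λ X → g (just ⊕ ∷ X)) xor ∑± (λ X → g (just ⊖ ∷ X))

∑±-cong : ∀ {n} {g h : SignVec n → Bool} → (∀ X → g X ≡ h X) → ∑± g ≡ ∑± h
∑±-cong {zero}  e = e []
∑±-cong {suc n} e = cong₂ _xor_ (∑±-cong λ X → e (just ⊕ ∷ X)) (∑±-cong λ X → e (just ⊖ ∷ X))

∑±-xor : ∀ {n} (g h : SignVec n → Bool) → ∑± (λ X → g X xor h X) ≡ ∑± g xor ∑± h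
∑±-xor {zero}  g h = refl
∑±-xor {suc n} g h = trans (cong₂ _xor_ (∑±-xor {n} _ _) (∑±-xor {n} _ _))
  (xor-interchange (∑± {n} λ X → g (just ⊕ ∷ X)) _ _ _)

∑±-false : ∀ n → ∑± {n} (λ _ → false) ≡ false
∑±-false zero    = refl
∑±-false (suc n) = xor-same (∑± {n} λ _ → false)

∑±-neg : ∀ {n} (g : SignVec n → Bool) → ∑± (λ X → g (neg X)) ≡ ∑± g
∑±-neg {zero}  g = refl
∑±-neg {suc n} g = trans (cong₂ _xor_ (∑±-neg {n} _) (∑±-neg {n} _))
  (xor-comm (∑± {n} λ X → g (just ⊖ ∷ X)) _)

-- A facet of a full sign vector lies in exactly two full sign vectors.
∑±-∂ : ∀ {n} (g : SignVec n → Bool) → ∑± (∂ g) ≡ false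
∑±-∂ {zero}  g = refl
∑±-∂ {suc n} g = begin
  ∑± (λ X → a X xor ∂ (λ Y → g (just ⊕ ∷ Y)) X) xor ∑± (λ X → a X xor ∂ (λ Y → g (just ⊖ ∷ Y)) X)
    ≡⟨ cong₂ _xor_ (∑±-xor a _) (∑±-xor a _) ⟩
  (∑± a xor ∑± {n} (∂ (λ Y → g (just ⊕ ∷ Y)))) xor (∑± a xor ∑± {n} (∂ (λ Y → g (just ⊖ ∷ Y))))
    ≡⟨ cong₂ (λ b c → (∑± a xor b) xor (∑± a xor c)) (∑±-∂ λ Y → g (just ⊕ ∷ Y)) (∑±-∂ λ Y → g (just ⊖ ∷ Y)) ⟩
  (∑± a xor false) xor (∑± a xor false)
    ≡⟨ xor-same (∑± a xor false) ⟩
  false ∎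
  where open ≡-Reasoning
        a : SignVec n → Bool
        a X = g (nothing ∷ X)

-- Alternating lists of labels and their boundary.

Label : ℕ → Set
Label m = Sign × Fin m

opp : ∀ {m} → Label m → Label m
opp (s , j) = opposite s , j

-- The mod 2 sum of `f` over the lists with one entry deleted, that is, `f` evaluated on the
-- boundary of a simplex of labels.
δ : ∀ {A : Set} → (List A → Bool) → List A → Bool
δ f []      = false
δ f (a ∷ ℓ) = f ℓ xor δ (λ ℓ′ → f (a ∷ ℓ′)) ℓ

δ-false : ∀ {A : Set} (ℓ : List A) → δ (λ _ → false) ℓ ≡ false
δ-false []      = refl
δ-false (a ∷ ℓ) = δ-false ℓ

δ-∂ : ∀ {A : Set} {n} (X : SignVec n) (h : SignVec n → List A → Bool) ℓ →
      ∂ (λ Y → δ (h Y) ℓ) X ≡ δ (λ ℓ′ → ∂ (λ Y → h Y ℓ′) X) ℓ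
δ-∂ X h []      = ∂-false X
δ-∂ X h (a ∷ ℓ) = trans
  (∂-xor X (λ Y → h Y ℓ) (λ Y → δ (λ ℓ′ → h Y (a ∷ ℓ′)) ℓ))
  (cong (∂ (λ Y → h Y ℓ) X xor_) (δ-∂ X (λ Y ℓ′ → h Y (a ∷ ℓ′)) ℓ))

module _ {m : ℕ} where

  -- Separates the labels of least absolute value, so that alternation can be tested by recursion on
  -- `m`. Repetitions are kept, because they must spoil alternation.
  zeros : List (Label (suc m)) → List Sign
  zeros []                 = []
  zeros ((s , fzero) ∷ ℓ)  = s ∷ zeros ℓ
  zeros ((s , fsuc j) ∷ ℓ) = zeros ℓ

  rest : List (Label (suc m)) → List (Label m)
  rest []                 = []
  rest ((s , fzero) ∷ ℓ)  = rest ℓ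
  rest ((s , fsuc j) ∷ ℓ) = (s , j) ∷ rest ℓ

  -- A Leibniz rule: the deleted entry belongs to exactly one of the two parts.
  δ-split : ∀ (g : List Sign → List (Label m) → Bool) ℓ →
    δ (λ ℓ′ → g (zeros ℓ′) (rest ℓ′)) ℓ ≡
    δ (λ z → g z (rest ℓ)) (zeros ℓ) xor δ (g (zeros ℓ)) (rest ℓ)
  δ-split g []                 = refl
  δ-split g ((s , fzero) ∷ ℓ)  =
    trans (cong (g (zeros ℓ) (rest ℓ) xor_) (δ-split (λ z → g (s ∷ z)) ℓ))
          (sym (xor-assoc (g (zeros ℓ) (rest ℓ)) (δ (λ z → g (s ∷ z) (rest ℓ)) (zeros ℓ))
                          (δ (g (s ∷ zeros ℓ)) (rest ℓ))))
  δ-split g ((s , fsuc j) ∷ ℓ) =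
    trans (cong (g (zeros ℓ) (rest ℓ) xor_) (δ-split (λ z r → g z ((s , j) ∷ r)) ℓ))
          (swap (g (zeros ℓ) (rest ℓ)) (δ (λ z → g z ((s , j) ∷ rest ℓ)) (zeros ℓ))
                (δ (λ r → g (zeros ℓ) ((s , j) ∷ r)) (rest ℓ)))
    where
    open xor-∧-Solver
    swap : ∀ a b c → a xor (b xor c) ≡ b xor (a xor c)
    swap = solve 3 (λ a b c → a :+ (b :+ c) := b :+ (a :+ c)) refl

-- alt ε ℓ holds when the labels in ℓ, sorted by absolute value, have distinct
-- absolute values and alternating signs, the first sign being ε.
step : Sign → (Sign → Bool) → List Sign → Bool
step ε a []           = a ε
step ε a (_ ∷ _ ∷ _)  = false
step ⊕ a (⊕ ∷ [])     = a ⊖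
step ⊕ a (⊖ ∷ [])     = false
step ⊖ a (⊕ ∷ [])     = false
step ⊖ a (⊖ ∷ [])     = a ⊕

alt : ∀ {m} → Sign → List (Label m) → Bool
alt {zero}  ε ℓ = List.null ℓ
alt {suc m} ε ℓ = step ε (λ η → alt η (rest ℓ)) (zeros ℓ)

NonCompl : ∀ {m} → Label m → Label m → Set
NonCompl a b = b ≢ opp a

private
  All-rest : ∀ {m} {s j} (ℓ : List (Label (suc m))) →
             All (NonCompl (s , fsuc j)) ℓ → All (NonCompl (s , j)) (rest ℓ)
  All-rest []                 []      = []
  All-rest ((t , fzero) ∷ ℓ)  (_ ∷ r) = All-rest ℓ r
  All-rest ((t , fsuc i) ∷ ℓ) (h ∷ r) = (λ e → h (cong (λ { (u , k) → u , fsuc k }) e)) ∷ All-rest ℓ r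

  All-zeros : ∀ {m} {s} (ℓ : List (Label (suc m))) →
              All (NonCompl (s , fzero)) ℓ → All (λ t → t ≢ opposite s) (zeros ℓ)
  All-zeros []                 []      = []
  All-zeros ((t , fzero) ∷ ℓ)  (h ∷ r) = (λ e → h (cong (_, fzero) e)) ∷ All-zeros ℓ r
  All-zeros ((t , fsuc i) ∷ ℓ) (_ ∷ r) = All-zeros ℓ r

  AllPairs-rest : ∀ {m} (ℓ : List (Label (suc m))) → AllPairs NonCompl ℓ → AllPairs NonCompl (rest ℓ)
  AllPairs-rest []                 []      = []
  AllPairs-rest ((t , fzero) ∷ ℓ)  (_ ∷ r) = AllPairs-rest ℓ r
  AllPairs-rest ((t , fsuc i) ∷ ℓ) (h ∷ r) = All-rest ℓ h ∷ AllPairs-rest ℓ r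

  AllPairs-zeros : ∀ {m} (ℓ : List (Label (suc m))) → AllPairs NonCompl ℓ →
                   AllPairs (λ s t → t ≢ opposite s) (zeros ℓ)
  AllPairs-zeros []                 []      = []
  AllPairs-zeros ((t , fzero) ∷ ℓ)  (h ∷ r) = All-zeros ℓ h ∷ AllPairs-zeros ℓ r
  AllPairs-zeros ((t , fsuc i) ∷ ℓ) (_ ∷ r) = AllPairs-zeros ℓ r

  -- The number of labels of least absolute value decides. Two equal ones give two faces that
  -- cancel, two opposite ones are excluded, and with three or more every face still has a
  -- repetition.
  δ-step : ∀ {m} ε (r : List (Label m)) (z : List Sign) →
    (∀ η → δ (alt η) r ≡ alt ⊕ r xor alt ⊖ r) → AllPairs (λ s t → t ≢ opposite s) z →
    δ (step ε (λ η → alt η r)) z xor δ (λ r′ → step ε (λ η → alt η r′) z) r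
    ≡ step ⊕ (λ η → alt η r) z xor step ⊖ (λ η → alt η r) z
  δ-step ε r []       h _ = h ε
  δ-step ⊕ r (⊕ ∷ []) h _ rewrite h ⊖ = lem (alt ⊕ r) (alt ⊖ r)
    where lem : ∀ a b → (a xor false) xor (a xor b) ≡ b xor false
          lem = solve 2 (λ a b → (a :+ con false) :+ (a :+ b) := b :+ con false) refl where open xor-∧-Solver
  δ-step ⊕ r (⊖ ∷ []) h _ rewrite δ-false r = trans (xor-identityʳ _) (xor-identityʳ _)
  δ-step ⊖ r (⊕ ∷ []) h _ rewrite δ-false r = xor-identityʳ _
  δ-step ⊖ r (⊖ ∷ []) h _ rewrite h ⊕ = lem (alt ⊕ r) (alt ⊖ r)
    where lem : ∀ a b → (b xor false) xor (a xor b) ≡ a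
          lem = solve 2 (λ a b → (b :+ con false) :+ (a :+ b) := a) refl where open xor-∧-Solver
  δ-step ε r (⊕ ∷ ⊖ ∷ z) h ((c ∷ _) ∷ _) = ⊥-elim (c refl)
  δ-step ε r (⊖ ∷ ⊕ ∷ z) h ((c ∷ _) ∷ _) = ⊥-elim (c refl)
  δ-step ⊕ r (⊕ ∷ ⊕ ∷ []) h _ rewrite δ-false r = lem (alt ⊖ r)
    where lem : ∀ a → (a xor (a xor false)) xor false ≡ false
          lem = solve 1 (λ a → (a :+ (a :+ con false)) :+ con false := con false) refl where open xor-∧-Solver
  δ-step ⊕ r (⊖ ∷ ⊖ ∷ []) h _ rewrite δ-false r = refl
  δ-step ⊖ r (⊕ ∷ ⊕ ∷ []) h _ rewrite δ-false r = refl
  δ-step ⊖ r (⊖ ∷ ⊖ ∷ []) h _ rewrite δ-false r = lem (alt ⊕ r)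
    where lem : ∀ a → (a xor (a xor false)) xor false ≡ false
          lem = solve 1 (λ a → (a :+ (a :+ con false)) :+ con false := con false) refl where open xor-∧-Solver
  δ-step ε r (_ ∷ _ ∷ _ ∷ z) h _ rewrite δ-false r = trans (xor-identityʳ (δ (λ _ → false) z)) (δ-false z)

-- The local step of Fan's argument. An alternating list has exactly one face alternating from `ε`,
-- obtained by dropping its first or last label in sorted order. A non-alternating list without
-- complementary pair has none or two.
δ-alt : ∀ {m} ε (ℓ : List (Label m)) → AllPairs NonCompl ℓ → δ (alt ε) ℓ ≡ alt ⊕ ℓ xor alt ⊖ ℓ
δ-alt {zero}  ε []           _ = refl
δ-alt {zero}  ε ((_ , ()) ∷ _)
δ-alt {suc m} ε ℓ good = trans
  (δ-split (λ z r → step ε (λ η → alt η r) z) ℓ)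
  (δ-step ε (rest ℓ) (zeros ℓ) (λ η → δ-alt η (rest ℓ) (AllPairs-rest ℓ good)) (AllPairs-zeros ℓ good))

alt-[] : ∀ {m} ε → alt {m} ε [] ≡ true
alt-[] {zero}  ε = refl
alt-[] {suc m} ε = alt-[] {m} ε

alt-opp : ∀ {m} ε (ℓ : List (Label m)) → alt ε (List.map opp ℓ) ≡ alt (opposite ε) ℓ
alt-opp {zero}  ε []             = refl
alt-opp {zero}  ε ((_ , ()) ∷ _)
alt-opp {suc m} ε ℓ =
  trans (cong₂ (λ z r → step ε (λ η → alt η r) z) (zeros-opp ℓ) (rest-opp ℓ)) (step-opp ε (zeros ℓ))
  where
  zeros-opp : ∀ ℓ → zeros {m} (List.map opp ℓ) ≡ List.map opposite (zeros ℓ)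
  zeros-opp []                 = refl
  zeros-opp ((s , fzero) ∷ ℓ)  = cong (opposite s ∷_) (zeros-opp ℓ)
  zeros-opp ((s , fsuc j) ∷ ℓ) = zeros-opp ℓ
  rest-opp : ∀ ℓ → rest {m} (List.map opp ℓ) ≡ List.map opp (rest ℓ)
  rest-opp []                 = refl
  rest-opp ((s , fzero) ∷ ℓ)  = rest-opp ℓ
  rest-opp ((s , fsuc j) ∷ ℓ) = cong ((opposite s , j) ∷_) (rest-opp ℓ)
  step-opp : ∀ ε z → step ε (λ η → alt η (List.map opp (rest ℓ))) (List.map opposite z)
                     ≡ step (opposite ε) (λ η → alt η (rest ℓ)) z
  step-opp ε []          = alt-opp ε (rest ℓ)
  step-opp ⊕ (⊕ ∷ [])    = refl
  step-opp ⊕ (⊖ ∷ [])    = alt-opp ⊖ (rest ℓ)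
  step-opp ⊖ (⊕ ∷ [])    = alt-opp ⊕ (rest ℓ)
  step-opp ⊖ (⊖ ∷ [])    = refl
  step-opp ⊕ (_ ∷ _ ∷ _) = refl
  step-opp ⊖ (_ ∷ _ ∷ _) = refl

-- Alternation requires distinct absolute values, and only `m` exist.
alt-long : ∀ {m} ε (ℓ : List (Label m)) → m < length ℓ → alt ε ℓ ≡ false
alt-long {zero}  ε (_ ∷ _) _ = refl
alt-long {suc m} ε ℓ m<ℓ = step-long ε (zeros ℓ) (subst (suc m <_) (sym (length-split ℓ)) m<ℓ)
  where
  length-split : ∀ ℓ → length (zeros {m} ℓ) + length (rest ℓ) ≡ length ℓ
  length-split []                 = refl
  length-split ((s , fzero) ∷ ℓ)  = cong suc (length-split ℓ)
  length-split ((s , fsuc j) ∷ ℓ) = trans (+-suc _ _) (cong suc (length-split ℓ))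
  step-long : ∀ ε z → suc m < length z + length (rest ℓ) → step ε (λ η → alt η (rest ℓ)) z ≡ false
  step-long ε []       h       = alt-long ε (rest ℓ) (<⇒≤ h)
  step-long ⊕ (⊕ ∷ []) (s≤s h) = alt-long ⊖ (rest ℓ) h
  step-long ⊕ (⊖ ∷ []) h       = refl
  step-long ⊖ (⊕ ∷ []) h       = refl
  step-long ⊖ (⊖ ∷ []) (s≤s h) = alt-long ⊕ (rest ℓ) h
  step-long ⊕ (_ ∷ _ ∷ _) h    = refl
  step-long ⊖ (_ ∷ _ ∷ _) h    = refl

-- Φ f k X ℓ is the sum (mod 2) of f (lab Xₖ₋₁ ∷ … ∷ lab X₁ ∷ lab X ∷ ℓ) over the
-- chains X ⊐ X₁ ⊐ … ⊐ Xₖ in which every step deletes one sign.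
module Chains {n m : ℕ} (lab : SignVec n → Label m) where

  Φ : (List (Label m) → Bool) → ℕ → SignVec n → List (Label m) → Bool
  Φ f zero    X ℓ = f ℓ
  Φ f (suc k) X ℓ = ∂ (λ Y → Φ f k Y (lab X ∷ ℓ)) X

  Φ-cong-length : ∀ {f g} k X ℓ → (∀ ℓ′ → length ℓ′ ≡ k + length ℓ → f ℓ′ ≡ g ℓ′) → Φ f k X ℓ ≡ Φ g k X ℓ
  Φ-cong-length zero    X ℓ e = e ℓ refl
  Φ-cong-length (suc k) X ℓ e = ∂-cong X λ _ Y _ →
    Φ-cong-length k Y (lab X ∷ ℓ) λ ℓ′ p → e ℓ′ (trans p (+-suc k (length ℓ)))

  Φ-false : ∀ k X ℓ → Φ (λ _ → false) k X ℓ ≡ false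
  Φ-false zero    X ℓ = refl
  Φ-false (suc k) X ℓ = trans (∂-cong X λ _ Y _ → Φ-false k Y (lab X ∷ ℓ)) (∂-false X)

  Φ-xor : ∀ f g k X ℓ → Φ (λ ℓ′ → f ℓ′ xor g ℓ′) k X ℓ ≡ Φ f k X ℓ xor Φ g k X ℓ
  Φ-xor f g zero    X ℓ = refl
  Φ-xor f g (suc k) X ℓ = trans (∂-cong X λ _ Y _ → Φ-xor f g k Y (lab X ∷ ℓ))
    (∂-xor X (λ Y → Φ f k Y (lab X ∷ ℓ)) (λ Y → Φ g k Y (lab X ∷ ℓ)))

  -- Stokes: among the faces of the chains below X, those omitting an inner
  -- element cancel because ∂∂ = 0.
  Φ-δ : ∀ f k X ℓ →
    Φ (δ f) (suc k) X ℓ ≡ ∂ (λ Y → Φ f k Y ℓ) X xor δ (Φ f (suc k) X) ℓ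
  Φ-δ f zero X ℓ = trans (∂-xor X (λ _ → f ℓ) (λ _ → δ (λ ℓ′ → f (lab X ∷ ℓ′)) ℓ))
    (cong (∂ (λ _ → f ℓ) X xor_) (δ-∂ X (λ _ ℓ′ → f (lab X ∷ ℓ′)) ℓ))
  Φ-δ f (suc k) X ℓ = begin
    ∂ (λ Y → Φ (δ f) (suc k) Y (lab X ∷ ℓ)) X
      ≡⟨ ∂-cong X (λ _ Y _ → Φ-δ f k Y (lab X ∷ ℓ)) ⟩
    ∂ (λ Y → ∂ a Y xor (b Y xor d Y)) X
      ≡⟨ ∂-xor X (∂ a) (λ Y → b Y xor d Y) ⟩
    ∂ (∂ a) X xor ∂ (λ Y → b Y xor d Y) X
      ≡⟨ cong₂ _xor_ (∂∂ X a) (∂-xor X b d) ⟩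
    ∂ b X xor ∂ d X
      ≡⟨ cong (∂ b X xor_) (δ-∂ X (λ Y ℓ′ → Φ f (suc k) Y (lab X ∷ ℓ′)) ℓ) ⟩
    ∂ b X xor δ (Φ f (suc (suc k)) X) ℓ ∎
    where
    open ≡-Reasoning
    a b d : SignVec n → Bool
    a Y = Φ f k Y (lab X ∷ ℓ)
    b Y = Φ f (suc k) Y ℓ
    d Y = δ (λ ℓ′ → Φ f (suc k) Y (lab X ∷ ℓ′)) ℓ

  module _ (no-compl : ∀ X Y → NonZero X → X ⊑ Y → NonCompl (lab X) (lab Y)) where

    -- The last hypothesis is the invariant of the descent: labels already collected come from
    -- vectors above `X`, so no nonzero vector below `X` has a label complementary to one of them.
    Φ-cong-chain : ∀ {f g} → (∀ ℓ → AllPairs NonCompl ℓ → f ℓ ≡ g ℓ) →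
      ∀ k X ℓ → AllPairs NonCompl ℓ →
      All (λ a → ∀ Y → NonZero Y → Y ⊑ X → NonCompl (lab Y) a) ℓ →
      Φ f k X ℓ ≡ Φ g k X ℓ
    Φ-cong-chain e zero    X ℓ good above = e ℓ good
    Φ-cong-chain e (suc k) X ℓ good above = ∂-cong X λ nz Y Y⊑X →
      Φ-cong-chain e k Y (lab X ∷ ℓ)
        (All.map (λ h → h X nz ⊑-refl) above ∷ good)
        ((λ Z nzZ Z⊑Y → no-compl Z X nzZ (⊑-trans Z⊑Y Y⊑X))
          ∷ All.map (λ h Z nzZ Z⊑Y → h Z nzZ (⊑-trans Z⊑Y Y⊑X)) above)

  module _ (antipodal : ∀ X → NonZero X → lab (neg X) ≡ opp (lab X)) where

    Φ-neg : ∀ f k X ℓ → Φ f k (neg X) (List.map opp ℓ) ≡ Φ (λ ℓ′ → f (List.map opp ℓ′)) k X ℓ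
    Φ-neg f zero    X ℓ = refl
    Φ-neg f (suc k) X ℓ = trans (∂-neg X (λ Y → Φ f k Y (lab (neg X) ∷ List.map opp ℓ)))
      (∂-cong X λ nz Y _ → trans
        (cong (λ a → Φ f k (neg Y) (a ∷ List.map opp ℓ)) (antipodal X nz))
        (Φ-neg f k Y (lab X ∷ ℓ)))

open Chains

Φ-restrict : ∀ {n m} (lab : SignVec (suc n) → Label m) f k X ℓ →
  Φ lab f k (nothing ∷ X) ℓ ≡ Φ (λ Y → lab (nothing ∷ Y)) f k X ℓ
Φ-restrict lab f zero    X ℓ = refl
Φ-restrict lab f (suc k) X ℓ = ∂-cong X λ _ Y _ → Φ-restrict lab f k Y (lab (nothing ∷ X) ∷ ℓ)

-- Antipodality folds the lower hemisphere onto the upper one, where by `δ-alt` and Stokes the count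
-- is a sum over facets. Facets inside the hemisphere cancel, leaving the equator, a sphere of one
-- dimension less. Chains with `n` deletions from a full vector never read the label of the zero
-- vector.
fan : ∀ {n m} (lab : SignVec n → Label m) →
  (∀ X → NonZero X → lab (neg X) ≡ opp (lab X)) →
  (∀ X Y → NonZero X → X ⊑ Y → NonCompl (lab X) (lab Y)) →
  ∑± (λ X → Φ lab (alt ⊕) n X []) ≡ true
fan {zero}  {m} lab anti compl = alt-[] {m} ⊕
fan {suc n} {m} lab anti compl = begin
  ∑± (λ X → F ⊕ (just ⊕ ∷ X)) xor ∑± (λ X → F ⊕ (just ⊖ ∷ X))
    ≡⟨ cong (∑± (λ X → F ⊕ (just ⊕ ∷ X)) xor_) (trans
         (sym (∑±-neg (λ X → F ⊕ (just ⊖ ∷ X))))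
         (∑±-cong λ X → trans (Φ-neg lab anti (alt ⊕) (suc n) (just ⊕ ∷ X) [])
            (Φ-cong-length lab (suc n) (just ⊕ ∷ X) [] λ ℓ _ → alt-opp ⊕ ℓ))) ⟩
  ∑± (λ X → F ⊕ (just ⊕ ∷ X)) xor ∑± (λ X → F ⊖ (just ⊕ ∷ X))
    ≡⟨ sym (∑±-xor (λ X → F ⊕ (just ⊕ ∷ X)) (λ X → F ⊖ (just ⊕ ∷ X))) ⟩
  ∑± (λ X → F ⊕ (just ⊕ ∷ X) xor F ⊖ (just ⊕ ∷ X))
    ≡⟨ ∑±-cong (λ X → facets (just ⊕ ∷ X)) ⟩
  ∑± (λ X → F′ (nothing ∷ X) xor ∂ (λ Y → F′ (just ⊕ ∷ Y)) X)
    ≡⟨ ∑±-xor (λ X → F′ (nothing ∷ X)) (∂ λ Y → F′ (just ⊕ ∷ Y)) ⟩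
  ∑± (λ X → F′ (nothing ∷ X)) xor ∑± (∂ λ Y → F′ (just ⊕ ∷ Y))
    ≡⟨ cong₂ _xor_ (∑±-cong λ X → Φ-restrict lab (alt ⊕) n X []) (∑±-∂ λ Y → F′ (just ⊕ ∷ Y)) ⟩
  ∑± (λ X → Φ (λ Y → lab (nothing ∷ Y)) (alt ⊕) n X []) xor false
    ≡⟨ cong (_xor false) (fan (λ Y → lab (nothing ∷ Y))
         (λ X nz → anti (nothing ∷ X) (Any.there nz))
         (λ X Y nz X⊑Y → compl (nothing ∷ X) (nothing ∷ Y) (Any.there nz) (≼-refl ∷ X⊑Y))) ⟩
  true ∎
  where
  open ≡-Reasoning
  F : Sign → SignVec (suc n) → Bool
  F ε X = Φ lab (alt ε) (suc n) X []
  F′ : SignVec (suc n) → Bool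
  F′ X = Φ lab (alt ⊕) n X []
  facets : ∀ X → F ⊕ X xor F ⊖ X ≡ ∂ F′ X
  facets X = begin
    F ⊕ X xor F ⊖ X
      ≡⟨ sym (Φ-xor lab (alt ⊕) (alt ⊖) (suc n) X []) ⟩
    Φ lab (λ ℓ → alt ⊕ ℓ xor alt ⊖ ℓ) (suc n) X []
      ≡⟨ sym (Φ-cong-chain lab compl (δ-alt ⊕) (suc n) X [] [] []) ⟩
    Φ lab (δ (alt ⊕)) (suc n) X []
      ≡⟨ Φ-δ lab (alt ⊕) n X [] ⟩
    ∂ F′ X xor false
      ≡⟨ xor-identityʳ (∂ F′ X) ⟩
    ∂ F′ X ∎

-- A full chain carries `n` labels, too many to alternate with only `m` absolute values, so the
-- count that `fan` makes odd would be zero.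
octahedral-tucker : ∀ {n m} (lab : SignVec n → Label m) → m < n →
  (∀ X → NonZero X → lab (neg X) ≡ opp (lab X)) →
  ¬ (∀ X Y → NonZero X → X ⊑ Y → NonCompl (lab X) (lab Y))
octahedral-tucker {n} {m} lab m<n anti compl = contradiction (trans (sym (fan lab anti compl)) even) λ ()
  where
  even : ∑± (λ X → Φ lab (alt ⊕) n X []) ≡ false
  even = trans (∑±-cong λ X → trans
    (Φ-cong-length lab n X [] λ ℓ p → alt-long ⊕ ℓ (subst (m <_) (sym (trans p (+-identityʳ n))) m<n))
    (Φ-false lab n X [])) (∑±-false n)

-- Kneser's conjecture

Disjoint : ∀ {n} → Subset n → Subset n → Set
Disjoint A B = ∀ i → ¬ (i ∈ A × i ∈ B)

size : ∀ {n} → SignVec n → ℕ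
size []            = 0
size (nothing ∷ X) = size X
size (just _ ∷ X)  = suc (size X)

has-sign : Sign → Maybe Sign → Bool
has-sign ⊕ (just ⊕) = true
has-sign ⊖ (just ⊖) = true
has-sign _ _        = false

side : ∀ {n} → Sign → SignVec n → Subset n
side s = Vec.map (has-sign s)

∈-side : ∀ {n} s (X : SignVec n) {i} → i ∈ side s X → lookup X i ≡ just s
∈-side ⊕ (just ⊕ ∷ X) here      = refl
∈-side ⊖ (just ⊖ ∷ X) here      = refl
∈-side s (x ∷ X)      (there p) = ∈-side s X p

sides-size : ∀ {n} (X : SignVec n) → ∣ side ⊕ X ∣ + ∣ side ⊖ X ∣ ≡ size X
sides-size []            = refl
sides-size (nothing ∷ X) = sides-size X
sides-size (just ⊕ ∷ X)  = cong suc (sides-size X)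
sides-size (just ⊖ ∷ X)  = trans (+-suc _ _) (cong suc (sides-size X))

side-neg : ∀ {n} s (X : SignVec n) → side s (neg X) ≡ side (opposite s) X
side-neg s []            = refl
side-neg ⊕ (nothing ∷ X) = cong (false ∷_) (side-neg ⊕ X)
side-neg ⊖ (nothing ∷ X) = cong (false ∷_) (side-neg ⊖ X)
side-neg ⊕ (just ⊕ ∷ X)  = cong (false ∷_) (side-neg ⊕ X)
side-neg ⊖ (just ⊕ ∷ X)  = cong (true ∷_)  (side-neg ⊖ X)
side-neg ⊕ (just ⊖ ∷ X)  = cong (true ∷_)  (side-neg ⊕ X)
side-neg ⊖ (just ⊖ ∷ X)  = cong (false ∷_) (side-neg ⊖ X)

size-neg : ∀ {n} (X : SignVec n) → size (neg X) ≡ size X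
size-neg []            = refl
size-neg (nothing ∷ X) = size-neg X
size-neg (just _ ∷ X)  = cong suc (size-neg X)

size-mono : ∀ {n} {X Y : SignVec n} → X ⊑ Y → size X ≤ size Y
size-mono []                                = z≤n
size-mono (nothing≼ {nothing} ∷ X⊑Y)        = size-mono X⊑Y
size-mono (nothing≼ {just _}  ∷ X⊑Y)        = m≤n⇒m≤1+n (size-mono X⊑Y)
size-mono (≼-refl {nothing}   ∷ X⊑Y)        = size-mono X⊑Y
size-mono (≼-refl {just _}    ∷ X⊑Y)        = s≤s (size-mono X⊑Y)

⊑-size-≡ : ∀ {n} {X Y : SignVec n} → X ⊑ Y → size X ≡ size Y → X ≡ Y
⊑-size-≡ []                         e = refl
⊑-size-≡ (nothing≼ {nothing} ∷ X⊑Y) e = cong (nothing ∷_) (⊑-size-≡ X⊑Y e)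
⊑-size-≡ (nothing≼ {just _}  ∷ X⊑Y) e = ⊥-elim (<-irrefl e (s≤s (size-mono X⊑Y)))
⊑-size-≡ (≼-refl {nothing}   ∷ X⊑Y) e = cong (nothing ∷_) (⊑-size-≡ X⊑Y e)
⊑-size-≡ (≼-refl {just s}    ∷ X⊑Y) e = cong (just s ∷_) (⊑-size-≡ X⊑Y (suc-injective e))

size≡0⇒¬NonZero : ∀ {n} (X : SignVec n) → size X ≡ 0 → ¬ NonZero X
size≡0⇒¬NonZero (nothing ∷ X) e (Any.there nz) = size≡0⇒¬NonZero X e nz

lead : ∀ {n} → SignVec n → Sign
lead []            = ⊕
lead (nothing ∷ X) = lead X
lead (just s ∷ X)  = s

lead-neg : ∀ {n} (X : SignVec n) → NonZero X → lead (neg X) ≡ opposite (lead X)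
lead-neg (nothing ∷ X) (Any.there nz) = lead-neg X nz
lead-neg (just s ∷ X)  _               = refl

sides-disjoint : ∀ {n} s {X Y : SignVec n} → X ⊑ Y → Disjoint (side s X) (side (opposite s) Y)
sides-disjoint s {X} {Y} X⊑Y i (i∈X , i∈Y)
  with lookup X i | lookup Y i | ∈-side s X i∈X | ∈-side (opposite s) Y i∈Y | PW.lookup X⊑Y i
... | _ | _ | refl | e | ≼-refl = s≢opposite[s] s (just-injective e)

opposite-involutive : ∀ s → opposite (opposite s) ≡ s
opposite-involutive ⊕ = refl
opposite-involutive ⊖ = refl

↑ˡ≢↑ʳ : ∀ {m n} (i : Fin m) (j : Fin n) → i ↑ˡ n ≢ m ↑ʳ j
↑ˡ≢↑ʳ {m} {n} i j e with trans (sym (splitAt-↑ˡ m i n)) (trans (cong (splitAt m) e) (splitAt-↑ʳ m n j))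
... | ()

module _ {n k r : ℕ} (col : Subset n → Fin r)
  (proper : ∀ A B → suc k ≤ ∣ A ∣ → suc k ≤ ∣ B ∣ → Disjoint A B → col A ≢ col B) where

  private
    -- Matoušek's labelling. Vectors with at most 2k signs use their size and leading sign. A larger
    -- one has a side with more than k elements and uses the colour of that side, the smaller colour
    -- if both qualify. As a relation it turns antipodality into a uniqueness statement.
    data LabelOf (X : SignVec n) : Label (k + k + r) → Set where
      small : ∀ s (s<2k : s < k + k) → size X ≡ suc s → LabelOf X (lead X , fromℕ< s<2k ↑ˡ r)
      large : ∀ σ → k + k < size X → suc k ≤ ∣ side σ X ∣ →
        (suc k ≤ ∣ side (opposite σ) X ∣ → toℕ (col (side σ X)) < toℕ (col (side (opposite σ) X))) →
        LabelOf X (σ , (k + k) ↑ʳ col (side σ X))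

    large-label : ∀ X → k + k < size X → ∃ (LabelOf X)
    large-label X 2k<X with suc k ≤? ∣ side ⊕ X ∣ | suc k ≤? ∣ side ⊖ X ∣
    ... | yes p | no ¬q = _ , large ⊕ 2k<X p (λ q → ⊥-elim (¬q q))
    ... | no ¬p | yes q = _ , large ⊖ 2k<X q (λ p → ⊥-elim (¬p p))
    ... | no ¬p | no ¬q = ⊥-elim (<⇒≱ 2k<X (subst (_≤ k + k) (sides-size X)
                            (+-mono-≤ (≤-pred (≰⇒> ¬p)) (≤-pred (≰⇒> ¬q)))))
    ... | yes p | yes q with <-cmp (toℕ (col (side ⊕ X))) (toℕ (col (side ⊖ X)))
    ...   | tri< a _ _ = _ , large ⊕ 2k<X p (λ _ → a)
    ...   | tri≈ _ b _ = ⊥-elim (proper _ _ p q (sides-disjoint ⊕ ⊑-refl) (toℕ-injective b))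
    ...   | tri> _ _ c = _ , large ⊖ 2k<X q (λ _ → c)

    label : ∀ X → Σ (Label (k + k + r)) λ a → NonZero X → LabelOf X a
    label X with size X in eq
    -- The zero vector is exempt from every condition, so its label is arbitrary. Taking it from
    -- `col` also works when `k` is 0.
    ... | zero  = (⊕ , (k + k) ↑ʳ col (side ⊕ X)) , λ nz → ⊥-elim (size≡0⇒¬NonZero X eq nz)
    ... | suc s with s <? k + k
    ...   | yes s<2k = _ , λ _ → small s s<2k eq
    ...   | no  s≮2k with large-label X (subst (k + k <_) (sym eq) (s≤s (≮⇒≥ s≮2k)))
    ...     | a , h = a , λ _ → h

    sign-cases : ∀ σ τ → σ ≡ τ ⊎ τ ≡ opposite σ
    sign-cases ⊕ ⊕ = inj₁ refl
    sign-cases ⊕ ⊖ = inj₂ refl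
    sign-cases ⊖ ⊕ = inj₂ refl
    sign-cases ⊖ ⊖ = inj₁ refl

    LabelOf-unique : ∀ {X a b} → LabelOf X a → LabelOf X b → a ≡ b
    LabelOf-unique {X} (small s p e) (small t q e′) =
      cong (λ j → lead X , j ↑ˡ r) (fromℕ<-cong s t (suc-injective (trans (sym e) e′)) p q)
    LabelOf-unique (small s p e) (large σ 2k<X _ _) = ⊥-elim (<⇒≱ 2k<X (subst (_≤ k + k) (sym e) p))
    LabelOf-unique (large σ 2k<X _ _) (small s p e) = ⊥-elim (<⇒≱ 2k<X (subst (_≤ k + k) (sym e) p))
    LabelOf-unique (large σ _ p h) (large τ _ q h′) with sign-cases σ τ
    ... | inj₁ refl = refl
    ... | inj₂ refl rewrite opposite-involutive σ = ⊥-elim (<-asym (h q) (h′ p))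

    LabelOf-neg : ∀ {X a} → NonZero X → LabelOf X a → LabelOf (neg X) (opp a)
    LabelOf-neg {X} nz (small s p e) = subst (λ σ → LabelOf (neg X) (σ , fromℕ< p ↑ˡ r)) (lead-neg X nz)
      (small s p (trans (size-neg X) e))
    LabelOf-neg {X} nz (large σ 2k<X p h) =
      subst (λ A → LabelOf (neg X) (opposite σ , (k + k) ↑ʳ col A)) flip
        (large (opposite σ) (subst (k + k <_) (sym (size-neg X)) 2k<X)
          (subst (λ A → suc k ≤ ∣ A ∣) (sym flip) p)
          (subst₂ (λ A B → suc k ≤ ∣ B ∣ → toℕ (col A) < toℕ (col B)) (sym flip) (sym flop) h))
      where
      flip : side (opposite σ) (neg X) ≡ side σ X
      flip = trans (side-neg (opposite σ) X) (cong (λ τ → side τ X) (opposite-involutive σ))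
      flop : side (opposite (opposite σ)) (neg X) ≡ side (opposite σ) X
      flop = trans (cong (λ τ → side τ (neg X)) (opposite-involutive σ)) (side-neg σ X)

    -- For small vectors equal indices mean equal sizes, hence `X` and `Y` coincide and have the
    -- same leading sign. For large ones, a side of `X` and the opposite side of `Y` are disjoint
    -- and so differ in colour.
    LabelOf-compl : ∀ {X Y a b} → X ⊑ Y → LabelOf X a → LabelOf Y b → b ≢ opp a
    LabelOf-compl {X} {Y} X⊑Y (small s p e) (small t q e′) eq =
      s≢opposite[s] (lead X) (trans (cong lead X≡Y) (cong proj₁ eq))
      where
      t≡s : t ≡ s
      t≡s = trans (sym (toℕ-fromℕ< q)) (trans (cong toℕ (↑ˡ-injective r (fromℕ< q) (fromℕ< p) (cong proj₂ eq))) (toℕ-fromℕ< p))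
      X≡Y : X ≡ Y
      X≡Y = ⊑-size-≡ X⊑Y (trans e (trans (cong suc (sym t≡s)) (sym e′)))
    LabelOf-compl X⊑Y (small s p e) (large σ _ _ _) eq = ↑ˡ≢↑ʳ (fromℕ< p) _ (sym (cong proj₂ eq))
    LabelOf-compl X⊑Y (large σ _ _ _) (small s p e) eq = ↑ˡ≢↑ʳ (fromℕ< p) _ (cong proj₂ eq)
    LabelOf-compl {X} {Y} X⊑Y (large σ _ p _) (large τ _ q _) eq with cong proj₁ eq
    ... | refl = proper (side σ X) (side (opposite σ) Y) p q (sides-disjoint σ X⊑Y)
                   (sym (↑ʳ-injective (k + k) _ _ (cong proj₂ eq)))

  lovász-kneser : ¬ (k + k + r < n)
  lovász-kneser m<n = octahedral-tucker (λ X → proj₁ (label X)) m<n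
    (λ X nz → LabelOf-unique (proj₂ (label (neg X)) (nz-neg X nz)) (LabelOf-neg nz (proj₂ (label X) nz)))
    (λ X Y nz X⊑Y → LabelOf-compl X⊑Y (proj₂ (label X) nz) (proj₂ (label Y) (nz-mono nz X⊑Y)))
    where
    nz-neg : ∀ {n} (X : SignVec n) → NonZero X → NonZero (neg X)
    nz-neg (just _ ∷ X)  (Any.here px)  = Any.here (MAny.just tt)
    nz-neg (x ∷ X)       (Any.there nz) = Any.there (nz-neg X nz)
    nz-mono : ∀ {n} {X Y : SignVec n} → NonZero X → X ⊑ Y → NonZero Y
    nz-mono (Any.here px)  (≼-refl ∷ _) = Any.here px
    nz-mono (Any.there nz) (_ ∷ X⊑Y)    = Any.there (nz-mono nz X⊑Y)

-- Independent transversals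

sum-mono : ∀ {n} {f g : Fin n → ℕ} → (∀ i → f i ≤ g i) → sum f ≤ sum g
sum-mono {zero}  h = z≤n
sum-mono {suc n} h = +-mono-≤ (h fzero) (sum-mono (h ∘ fsuc))

sum-const : ∀ n {x} → sum {n} (λ _ → x) ≡ n * x
sum-const zero    = refl
sum-const (suc n) = cong (_ +_) (sum-const n)

sum-≤ : ∀ {n} {f : Fin n → ℕ} {x} → (∀ i → f i ≤ x) → sum f ≤ n * x
sum-≤ {n} h = ≤-trans (sum-mono h) (≤-reflexive (sum-const n))

sum<⇒∃< : ∀ {n} {f : Fin n → ℕ} {x} → sum f < n * x → ∃ λ i → f i < x
sum<⇒∃< {suc n} {f} {x} h with f fzero <? x
... | yes p = fzero , p
... | no ¬p with sum<⇒∃< {n} {f ∘ fsuc} {x}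
                 (+-cancelˡ-< x _ _ (≤-<-trans (+-monoˡ-≤ _ (≮⇒≥ ¬p)) h))
...   | i , q = fsuc i , q

term≤sum : ∀ {n} (f : Fin n → ℕ) i → f i ≤ sum f
term≤sum f fzero    = m≤m+n _ _
term≤sum f (fsuc i) = ≤-trans (term≤sum (f ∘ fsuc) i) (m≤n+m _ _)

sum≡0 : ∀ {n} (f : Fin n → ℕ) → sum f ≡ 0 → ∀ i → f i ≡ 0
sum≡0 f e i = n≤0⇒n≡0 (subst (f i ≤_) e (term≤sum f i))

indicator : ∀ {A : Set} → Dec A → ℕ
indicator d = if does d then 1 else 0

indicator≡0 : ∀ {A : Set} (d : Dec A) → indicator d ≡ 0 → ¬ A
indicator≡0 (no ¬a) _ = ¬a

fibre-≤1 : ∀ {s m} (α : Fin s → Fin m) → Injective _≡_ _≡_ α → ∀ z → sum (λ b → indicator (α b ≟ z)) ≤ 1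
fibre-≤1 {zero}  α inj z = z≤n
fibre-≤1 {suc s} α inj z with α fzero ≟ z
... | no _  = fibre-≤1 (α ∘ fsuc) (fsuc-injective ∘ inj) z
... | yes p = s≤s (≤-trans (sum-≤ {s} {x = 0} others) (≤-reflexive (*-zeroʳ s)))
  where
  others : ∀ i → indicator (α (fsuc i) ≟ z) ≤ 0
  others i with α (fsuc i) ≟ z
  ... | no _  = z≤n
  ... | yes q with inj (trans p (sym q))
  ...   | ()

-- Totals over all s^n functions take the place of expectations over a random one.
sumF : ∀ {s} n → ((Fin n → Fin s) → ℕ) → ℕ
sumF zero    g = g Vector.[]
sumF (suc n) g = sum λ b → sumF n λ f → g (b Vector.∷ f)

sumF-const : ∀ {s} n x → sumF {s} n (λ _ → x) ≡ s ^ n * x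
sumF-const     zero    x = sym (+-identityʳ x)
sumF-const {s} (suc n) x = begin
  sum {s} (λ _ → sumF {s} n λ _ → x) ≡⟨ sum-const s ⟩
  s * sumF {s} n (λ _ → x)           ≡⟨ cong (s *_) (sumF-const n x) ⟩
  s * (s ^ n * x)                    ≡⟨ *-assoc s (s ^ n) x ⟨
  s * s ^ n * x                      ∎
  where open ≡-Reasoning

sumF-swap : ∀ {s k} n (g : Fin k → (Fin n → Fin s) → ℕ) →
  sumF n (λ f → sum λ i → g i f) ≡ sum λ i → sumF n (g i)
sumF-swap zero    g = refl
sumF-swap {s} {k} (suc n) g = trans
  (sum-cong-≗ λ b → sumF-swap n λ i f → g i (b Vector.∷ f))
  (∑-comm λ b i → sumF n λ f → g i (b Vector.∷ f))

sumF-proj : ∀ {s} n (h : Fin s → ℕ) x → s * sumF n (λ f → h (f x)) ≡ s ^ n * sum h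
sumF-proj {s} (suc n) h fzero = begin
  s * sum (λ b → sumF n (λ (_ : Fin n → Fin s) → h b)) ≡⟨ cong (s *_) (sum-cong-≗ λ b → sumF-const n (h b)) ⟩
  s * sum (λ b → s ^ n * h b) ≡⟨ cong (s *_) (*-distribˡ-sum (s ^ n) h) ⟨
  s * (s ^ n * sum h)         ≡⟨ *-assoc s (s ^ n) (sum h) ⟨
  s * s ^ n * sum h           ∎
  where open ≡-Reasoning
sumF-proj {s} (suc n) h (fsuc x) = begin
  s * sum {s} (λ _ → sumF n λ f → h (f x)) ≡⟨ cong (s *_) (sum-const s) ⟩
  s * (s * sumF n (λ f → h (f x)))         ≡⟨ cong (s *_) (sumF-proj n h x) ⟩
  s * (s ^ n * sum h)                      ≡⟨ *-assoc s (s ^ n) (sum h) ⟨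
  s * s ^ n * sum h                        ∎
  where open ≡-Reasoning

-- Distinct coordinates are independent. Multiplying by `s` twice clears the denominator of the
-- probability of a given pair of values.
sumF-proj₂ : ∀ {s} n (h : Fin s → Fin s → ℕ) v x → v ≢ x →
  s * (s * sumF n (λ f → h (f v) (f x))) ≡ s ^ n * sum (λ b → sum (h b))
sumF-proj₂ n h fzero fzero v≢x = ⊥-elim (v≢x refl)
sumF-proj₂ {s} (suc n) h fzero (fsuc x) v≢x = begin
  s * (s * sum (λ b → sumF n λ f → h b (f x))) ≡⟨ cong (s *_) (*-distribˡ-sum s (λ b → sumF n λ f → h b (f x))) ⟩
  s * sum (λ b → s * sumF n λ f → h b (f x))   ≡⟨ cong (s *_) (sum-cong-≗ λ b → sumF-proj n (h b) x) ⟩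
  s * sum (λ b → s ^ n * sum (h b))            ≡⟨ cong (s *_) (*-distribˡ-sum (s ^ n) (λ b → sum (h b))) ⟨
  s * (s ^ n * sum (λ b → sum (h b)))          ≡⟨ *-assoc s (s ^ n) _ ⟨
  s * s ^ n * sum (λ b → sum (h b))            ∎
  where open ≡-Reasoning
sumF-proj₂ {s} (suc n) h (fsuc v) fzero v≢x = begin
  s * (s * sum (λ b′ → sumF n λ f → h (f v) b′)) ≡⟨ cong (s *_) (*-distribˡ-sum s (λ b′ → sumF n λ f → h (f v) b′)) ⟩
  s * sum (λ b′ → s * sumF n λ f → h (f v) b′)   ≡⟨ cong (s *_) (sum-cong-≗ λ b′ → sumF-proj n (λ b → h b b′) v) ⟩
  s * sum (λ b′ → s ^ n * sum (λ b → h b b′))    ≡⟨ cong (s *_) (*-distribˡ-sum (s ^ n) (λ b′ → sum (λ b → h b b′))) ⟨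
  s * (s ^ n * sum (λ b′ → sum (λ b → h b b′)))  ≡⟨ cong (λ z → s * (s ^ n * z)) (∑-comm λ b′ b → h b b′) ⟩
  s * (s ^ n * sum (λ b → sum (h b)))            ≡⟨ *-assoc s (s ^ n) _ ⟨
  s * s ^ n * sum (λ b → sum (h b))              ∎
  where open ≡-Reasoning
sumF-proj₂ {s} (suc n) h (fsuc v) (fsuc x) v≢x = begin
  s * (s * sum {s} (λ _ → sumF n λ f → h (f v) (f x))) ≡⟨ cong (λ z → s * (s * z)) (sum-const s) ⟩
  s * (s * (s * sumF n λ f → h (f v) (f x)))   ≡⟨ cong (s *_) (sumF-proj₂ n h v x (v≢x ∘ cong fsuc)) ⟩
  s * (s ^ n * sum (λ b → sum (h b)))          ≡⟨ *-assoc s (s ^ n) _ ⟨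
  s * s ^ n * sum (λ b → sum (h b))            ∎
  where open ≡-Reasoning

sumF<⇒∃0 : ∀ {s} n (g : (Fin n → Fin s) → ℕ) → sumF n g < s ^ n → ∃ λ f → g f ≡ 0
sumF<⇒∃0 zero    g h = Vector.[] , n<1⇒n≡0 h
sumF<⇒∃0 {s} (suc n) g h with sum<⇒∃< {s} h
... | b , h′ with sumF<⇒∃0 n (λ f → g (b Vector.∷ f)) h′
...   | f , e = (b Vector.∷ f) , e

-- First moment method: for a uniformly random `f` each of the at most p² pairs has expected cost at
-- most t/s. The expected total is below 1, so some `f` has total cost 0.
transversal : ∀ {p s t} (cost : Fin p → Fin p → Fin s → Fin s → ℕ) →
  (∀ v x b → sum (cost v x b) ≤ t) → p * (p * t) < s →
  ∃ λ (f : Fin p → Fin s) → ∀ v x → v ≢ x → cost v x (f v) (f x) ≡ 0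
transversal {p} {s@(suc _)} {t} cost bound p²t<s =
  let f , e = sumF<⇒∃0 p total cheap in f , free f e
  where
  -- The diagonal is zeroed because a coordinate is not independent of itself.
  cost′ : Fin p → Fin p → Fin s → Fin s → ℕ
  cost′ v x b b′ = if does (v ≟ x) then 0 else cost v x b b′

  total : (Fin p → Fin s) → ℕ
  total f = sum λ v → sum λ x → cost′ v x (f v) (f x)

  pair : ∀ v x → s * (s * sumF p (λ f → cost′ v x (f v) (f x))) ≤ s ^ p * (s * t)
  pair v x with v ≟ x
  ... | yes _  = ≤-trans (≤-reflexive (trans (cong (λ z → s * (s * z)) (trans (sumF-const {s} p 0) (*-zeroʳ (s ^ p))))
                   (trans (cong (s *_) (*-zeroʳ s)) (*-zeroʳ s)))) z≤n
  ... | no v≢x = ≤-trans (≤-reflexive (sumF-proj₂ p (cost v x) v x v≢x))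
                   (*-monoʳ-≤ (s ^ p) (sum-≤ (bound v x)))

  swap : sumF p total ≡ sum λ v → sum λ x → sumF p λ f → cost′ v x (f v) (f x)
  swap = trans (sumF-swap p λ v f → sum λ x → cost′ v x (f v) (f x))
    (sum-cong-≗ λ v → sumF-swap p λ x f → cost′ v x (f v) (f x))

  scaled : s * (s * sumF p total) ≤ p * (p * (s ^ p * (s * t)))
  scaled = begin
    s * (s * sumF p total)
      ≡⟨ cong (λ z → s * (s * z)) swap ⟩
    s * (s * sum λ v → sum λ x → c v x)
      ≡⟨ cong (s *_) (*-distribˡ-sum s (λ v → sum (c v))) ⟩
    s * (sum λ v → s * sum λ x → c v x)
      ≡⟨ *-distribˡ-sum s (λ v → s * sum (c v)) ⟩
    (sum λ v → s * (s * sum λ x → c v x))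
      ≡⟨ sum-cong-≗ (λ v → trans (cong (s *_) (*-distribˡ-sum s (c v))) (*-distribˡ-sum s (λ x → s * c v x))) ⟩
    (sum λ v → sum λ x → s * (s * c v x))
      ≤⟨ sum-≤ (λ v → sum-≤ (pair v)) ⟩
    p * (p * (s ^ p * (s * t))) ∎
    where open ≤-Reasoning
          c : Fin p → Fin p → ℕ
          c v x = sumF p λ f → cost′ v x (f v) (f x)

  cheap : sumF p total < s ^ p
  cheap = *-cancelˡ-< s _ _ (*-cancelˡ-< s _ _ (≤-<-trans scaled (begin-strict
    p * (p * (s ^ p * (s * t))) ≡⟨ reorder p s t (s ^ p) ⟩
    (s * s ^ p) * (p * (p * t)) <⟨ *-monoʳ-< (s * s ^ p) ⦃ m*n≢0 s (s ^ p) ⦃ _ ⦄ ⦃ m^n≢0 s p ⦄ ⦄ p²t<s ⟩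
    (s * s ^ p) * s             ≡⟨ *-comm (s * s ^ p) s ⟩
    s * (s * s ^ p)             ∎)))
    where
    open ≤-Reasoning
    reorder : ∀ p s t u → p * (p * (u * (s * t))) ≡ (s * u) * (p * (p * t))
    reorder = solve-∀

  free : ∀ f → total f ≡ 0 → ∀ v x → v ≢ x → cost v x (f v) (f x) ≡ 0
  free f e v x v≢x with v ≟ x | sum≡0 _ (sum≡0 (λ v → sum λ x → cost′ v x (f v) (f x)) e v) x
  ... | yes v≡x | _ = ⊥-elim (v≢x v≡x)
  ... | no _    | z = z

-- Shitov's lemma

module _ {V : Set} (G : Graph V) (loopless : Loopless G) where

  E⇒≢ : ∀ {x y} → E G x y → x ≢ y
  E⇒≢ {x} e refl = loopless x e

  triangle : ∀ {x y z} → E G x y → E G y z → E G z x → HasCycle G 3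
  triangle {x} {y} {z} xy yz zx = lookup vs , (λ {i} {j} → lookup-injective distinct i j)
    , (λ { fzero → xy ; (fsuc fzero) → yz }) , zx
    where
    vs : Vec V 3
    vs = x ∷ y ∷ z ∷ []
    distinct : Unique vs
    distinct = (E⇒≢ xy ∷ (E⇒≢ zx ∘ sym) ∷ []) ∷ (E⇒≢ yz ∷ []) ∷ [] ∷ []

  pentagon : ∀ {v w x y w′} → E G v w → E G w x → E G x y → E G y w′ → E G w′ v →
    v ≢ x → v ≢ y → w ≢ y → w ≢ w′ → x ≢ w′ → HasCycle G 5
  pentagon {v} {w} {x} {y} {w′} vw wx xy yw′ w′v v≢x v≢y w≢y w≢w′ x≢w′ =
    lookup vs , (λ {i} {j} → lookup-injective distinct i j)
    , (λ { fzero → vw ; (fsuc fzero) → wx ; (fsuc (fsuc fzero)) → xy ; (fsuc (fsuc (fsuc fzero))) → yw′ }) , w′v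
    where
    vs : Vec V 5
    vs = v ∷ w ∷ x ∷ y ∷ w′ ∷ []
    distinct : Unique vs
    distinct = (E⇒≢ vw ∷ v≢x ∷ v≢y ∷ (E⇒≢ w′v ∘ sym) ∷ []) ∷ (E⇒≢ wx ∷ w≢y ∷ w≢w′ ∷ [])
      ∷ (E⇒≢ xy ∷ x≢w′ ∷ []) ∷ (E⇒≢ yw′ ∷ []) ∷ [] ∷ []

-- suc (κ q) is the paper's c = 4q + 2, written so that it splits into the 2q + 2 robust and
-- the 2q background colours below.
κ : ℕ → ℕ
κ q = suc (q + q) + (q + q)

module Shitov {p q : ℕ} (G : Graph (Fin p)) (loopless : Loopless G)
  (no-C₃ : ¬ HasCycle G 3) (no-C₅ : ¬ HasCycle G 5) (p³≤2q : p * (p * p) < suc (q + q))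
  (Ψ : (Fin p × Fin q → Fin (suc (κ q))) → Fin (suc (κ q)))
  (proper : ∀ φ ψ → E (Exp (suc (κ q)) (Blowup G q)) φ ψ → Ψ φ ≢ Ψ ψ)
  (range : ∀ φ → ∃ λ x → Ψ φ ≡ φ x)
  (E? : ∀ x y → Dec (E G x y)) where

  c : ℕ
  c = suc (κ q)

  simple : (Fin p → Fin c) → Fin p × Fin q → Fin c
  simple φ (x , _) = φ x

  -- The witness is adjacent to every simple map that has the value `b` at `v` and elsewhere avoids
  -- all values of the witness. When `b` is not fragile (robust), each simple map coloured `b` takes
  -- the value `b` on the closed neighbourhood of `v`.
  Fragile : Fin p → Fin c → Set
  Fragile v b = ∃ λ (ψ : Fin p → Fin c) → Ψ (simple ψ) ≡ b × ψ v ≢ b × (∀ y → E G v y → ψ y ≢ b)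

  -- Pick a fragile colour at each vertex so that no chosen colour is a value of the witness at
  -- another vertex. The resulting map is coloured by its value at some `v`, yet it is adjacent to
  -- the witness at `v`, which has the same colour.
  fragile-few : (α : Fin p → Fin (suc (q + q)) → Fin c) → (∀ v → Injective _≡_ _≡_ (α v)) →
    ¬ (∀ v b → Fragile v (α v b))
  fragile-few α inj frag = let f , free = transversal cost bound p³≤2q in uncoloured f free
    where
    ψ : Fin p → Fin (suc (q + q)) → Fin p → Fin c
    ψ v b = proj₁ (frag v b)

    cost : Fin p → Fin p → Fin (suc (q + q)) → Fin (suc (q + q)) → ℕ
    -- Counts the conflicts between the colour chosen at `x` and the witness at `v`. Each of the `p`
    -- values of the witness hits at most one `b′`, whence the bound `p` per row.
    cost v x b b′ = sum λ y → indicator (α x b′ ≟ ψ v b y)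

    bound : ∀ v x b → sum (cost v x b) ≤ p
    bound v x b = ≤-trans (≤-reflexive (∑-comm λ b′ y → indicator (α x b′ ≟ ψ v b y)))
      (≤-trans (sum-≤ λ y → fibre-≤1 (α x) (inj x) (ψ v b y)) (≤-reflexive (*-identityʳ p)))

    uncoloured : ∀ f → (∀ v x → v ≢ x → cost v x (f v) (f x) ≡ 0) → ⊥
    uncoloured f free with range (simple λ x → α x (f x))
    ... | (v , _) , Ψφ≡ = proper (simple φ) (simple (ψ v (f v))) adj (trans Ψφ≡ (sym Ψψ≡))
      where
      φ : Fin p → Fin c
      φ x = α x (f x)
      Ψψ≡ : Ψ (simple (ψ v (f v))) ≡ φ v
      Ψψ≡ = proj₁ (proj₂ (frag v (f v)))
      adj : ∀ x y → E (Blowup G q) x y → simple φ x ≢ simple (ψ v (f v)) y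
      adj (x , _) (y , _) e with x ≟ v
      adj (x , _) (y , _) e                 | no x≢v =
        indicator≡0 (φ x ≟ ψ v (f v) y) (sum≡0 _ (free v x (x≢v ∘ sym)) y)
      adj (x , _) (y , _) (inj₁ e)          | yes refl = proj₂ (proj₂ (proj₂ (frag v (f v)))) y e ∘ sym
      adj (x , _) (_ , _) (inj₂ (refl , _)) | yes refl = proj₁ (proj₂ (proj₂ (frag v (f v)))) ∘ sym

  -- The maps `μ t`, equal to `τ t` outside the ball of radius 2 around `v`, are pairwise adjacent,
  -- so some `μ t` gets the colour `τ t`. The simple map that is `τ t` on the closed neighbourhood
  -- of `v` and another robust colour elsewhere also gets `τ t`, but is adjacent to `μ t`.
  module Robust (v : Fin p) (τ : Fin (suc (suc (q + q))) → Fin c) (τ-inj : Injective _≡_ _≡_ τ)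
    (robust : ∀ t → ¬ Fragile v (τ t)) where

    data Zone (u : Fin p) : Set where
      centre : u ≡ v → Zone u
      near   : E G v u → Zone u
      second : u ≢ v → ¬ E G v u → ∀ w → E G v w → E G w u → Zone u
      far    : u ≢ v → ¬ E G v u → (∀ w → E G v w → ¬ E G w u) → Zone u

    zone : ∀ u → Zone u
    zone u with u ≟ v | E? v u | any? (λ w → E? v w ×-dec E? w u)
    ... | yes u≡v | _     | _                  = centre u≡v
    ... | no  _   | yes e | _                  = near e
    ... | no u≢v  | no ¬e | yes (w , vw , wu)  = second u≢v ¬e w vw wu
    ... | no u≢v  | no ¬e | no none            = far u≢v ¬e λ w vw wu → none (w , vw , wu)

    background : ∃ λ (β : Fin (q + q) → Fin c) → Injective _≡_ _≡_ β × ∀ j → β j ∈ ∁ (image τ)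
    background = enumerate (∁ (image τ)) (q + q) (≤-reflexive (sym
      (trans (∣∁p∣≡n∸∣p∣ (image τ)) (trans (cong (c ∸_) (∣image∣ τ τ-inj)) (m+n∸m≡n (suc (suc (q + q))) (q + q))))))

    β : Fin (q + q) → Fin c
    β = proj₁ background

    β-inj : Injective _≡_ _≡_ β
    β-inj = proj₁ (proj₂ background)

    τ≢β : ∀ t j → τ t ≢ β j
    τ≢β t j e = x∈∁p⇒x∉p (proj₂ (proj₂ background) j) (subst (_∈ image τ) e (∈-image⁺ τ t))

    -- Even distances share one half of the background colours and odd ones use the other. All far
    -- vertices take the single colour `τ t`, which is harmless since only maps with different `t`
    -- are compared.
    paint : Fin (suc (suc (q + q))) → ∀ {u} → Zone u → Fin q → Fin c
    paint t (centre _)         i = β (i ↑ˡ q)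
    paint t (near _)           i = β (q ↑ʳ i)
    paint t (second _ _ _ _ _) i = β (i ↑ˡ q)
    paint t (far _ _ _)        i = τ t

    μ : Fin (suc (suc (q + q))) → Fin p × Fin q → Fin c
    μ t (u , i) = paint t (zone u) i

    -- Such an edge closes a triangle if the two middle vertices coincide and a pentagon through `v`
    -- otherwise.
    second-second : ∀ {x y w w′} → v ≢ x → ¬ E G v x → v ≢ y → ¬ E G v y →
      E G v w → E G w x → E G v w′ → E G w′ y → ¬ E G x y
    second-second {x} {y} {w} {w′} v≢x ¬vx v≢y ¬vy vw wx vw′ w′y xy with w ≟ w′
    ... | yes refl = no-C₃ (triangle G loopless wx xy (E-sym G w′y))
    ... | no w≢w′  = no-C₅ (pentagon G loopless vw wx xy (E-sym G w′y) (E-sym G vw′)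
                       v≢x v≢y (λ { refl → ¬vy vw }) w≢w′ (λ { refl → ¬vx vw′ }))

    -- The ball of radius 2 around v is bipartite, so the 2q background colours suffice for its blow-up.
    paint-edge : ∀ {t t′} → t ≢ t′ → ∀ {x y} (a : Zone x) (b : Zone y) i j → E G x y → paint t a i ≢ paint t′ b j
    paint-edge ne (far _ _ _)         (far _ _ _)           i j e eq = ne (τ-inj eq)
    paint-edge ne (far _ _ _)         (centre _)            i j e eq = τ≢β _ _ eq
    paint-edge ne (far _ _ _)         (near _)              i j e eq = τ≢β _ _ eq
    paint-edge ne (far _ _ _)         (second _ _ _ _ _)    i j e eq = τ≢β _ _ eq
    paint-edge ne (centre _)          (far _ _ _)           i j e eq = τ≢β _ _ (sym eq)
    paint-edge ne (near _)            (far _ _ _)           i j e eq = τ≢β _ _ (sym eq)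
    paint-edge ne (second _ _ _ _ _)  (far _ _ _)           i j e eq = τ≢β _ _ (sym eq)
    paint-edge ne (centre _)          (near _)              i j e eq = ↑ˡ≢↑ʳ i j (β-inj eq)
    paint-edge ne (second _ _ _ _ _)  (near _)              i j e eq = ↑ˡ≢↑ʳ i j (β-inj eq)
    paint-edge ne (near _)            (centre _)            i j e eq = ↑ˡ≢↑ʳ j i (sym (β-inj eq))
    paint-edge ne (near _)            (second _ _ _ _ _)    i j e eq = ↑ˡ≢↑ʳ j i (sym (β-inj eq))
    paint-edge ne (near vx)           (near vy)             i j e eq = no-C₃ (triangle G loopless vx e (E-sym G vy))
    paint-edge ne (centre refl)       (centre refl)         i j e eq = loopless v e
    paint-edge ne (centre refl)       (second _ ¬vy _ _ _)  i j e eq = ¬vy e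
    paint-edge ne (second _ ¬vx _ _ _) (centre refl)        i j e eq = ¬vx (E-sym G e)
    paint-edge ne (second x≢v ¬vx w vw wx) (second y≢v ¬vy w′ vw′ w′y) i j e eq =
      second-second (x≢v ∘ sym) ¬vx (y≢v ∘ sym) ¬vy vw wx vw′ w′y e

    paint-clique : ∀ {t t′} → t ≢ t′ → ∀ {x} (a : Zone x) {i j} → i ≢ j → paint t a i ≢ paint t′ a j
    paint-clique ne (centre _)         i≢j eq = i≢j (↑ˡ-injective q _ _ (β-inj eq))
    paint-clique ne (near _)           i≢j eq = i≢j (↑ʳ-injective q _ _ (β-inj eq))
    paint-clique ne (second _ _ _ _ _) i≢j eq = i≢j (↑ˡ-injective q _ _ (β-inj eq))
    paint-clique ne (far _ _ _)        i≢j eq = ne (τ-inj eq)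

    μ-adj : ∀ {t t′} → t ≢ t′ → E (Exp c (Blowup G q)) (μ t) (μ t′)
    μ-adj ne (x , i) (y , j) (inj₁ e)            = paint-edge ne (zone x) (zone y) i j e
    μ-adj ne (x , i) (_ , j) (inj₂ (refl , i≢j)) = paint-clique ne (zone x) i≢j

    paint-values : ∀ t {u} (a : Zone u) i → paint t a i ≡ τ t ⊎ ∃ λ j → paint t a i ≡ β j
    paint-values t (centre _)         i = inj₂ (_ , refl)
    paint-values t (near _)           i = inj₂ (_ , refl)
    paint-values t (second _ _ _ _ _) i = inj₂ (_ , refl)
    paint-values t (far _ _ _)        i = inj₁ refl

    Ψμ : ∀ t → Ψ (μ t) ≡ τ t ⊎ ∃ λ j → Ψ (μ t) ≡ β j
    Ψμ t with range (μ t)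
    ... | (u , i) , e with paint-values t (zone u) i
    ...   | inj₁ e′       = inj₁ (trans e e′)
    ...   | inj₂ (j , e′) = inj₂ (j , trans e e′)

    -- Otherwise 2q + 2 pairwise adjacent maps would share 2q background colours.
    some-τ : ∃ λ t → Ψ (μ t) ≡ τ t
    some-τ with any? (λ t → Ψ (μ t) ≟ τ t)
    ... | yes r = r
    ... | no none = ⊥-elim (contra (pigeonhole (<⇒≤ ≤-refl) (proj₁ ∘ back)))
      where
      back : ∀ t → ∃ λ j → Ψ (μ t) ≡ β j
      back t with Ψμ t
      ... | inj₁ e = ⊥-elim (none (t , e))
      ... | inj₂ r = r
      contra : _ → ⊥
      contra (t , t′ , t<t′ , e) = proper (μ t) (μ t′) (μ-adj (<⇒≢ t<t′))
        (trans (proj₂ (back t)) (trans (cong β e) (sym (proj₂ (back t′)))))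

    module _ (t t′ : Fin (suc (suc (q + q)))) (t≢t′ : t ≢ t′) where

      inner : ∀ u → Dec (u ≡ v ⊎ E G v u)
      inner u = (u ≟ v) ⊎-dec E? v u

      ψ : Fin p → Fin c
      ψ u with inner u
      ... | yes _ = τ t
      ... | no  _ = τ t′

      ψ-inner : ∀ u → u ≡ v ⊎ E G v u → ψ u ≡ τ t
      ψ-inner u h with inner u
      ... | yes _ = refl
      ... | no ¬h = ⊥-elim (¬h h)

      Ψψ : Ψ (simple ψ) ≡ τ t
      Ψψ with range (simple ψ)
      ... | (u , _) , e with inner u
      ...   | yes _ = e
      -- If `ψ` had the colour `τ t′`, it would itself witness that `τ t′` is fragile at `v`.
      ...   | no  _ = ⊥-elim (robust t′ (ψ , e , away (inj₁ refl) , λ y vy → away (inj₂ vy)))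
        where
        away : ∀ {y} → y ≡ v ⊎ E G v y → ψ y ≢ τ t′
        away {y} h eq = t≢t′ (τ-inj (trans (sym (ψ-inner y h)) eq))

      paint≢τ′ : ∀ {u} (a : Zone u) i → τ t′ ≢ paint t a i
      paint≢τ′ a i eq with paint-values t a i
      ... | inj₁ e       = t≢t′ (τ-inj (sym (trans eq e)))
      ... | inj₂ (j , e) = τ≢β t′ j (trans eq e)

      -- Only far vertices are painted `τ t`, and these neither lie in the closed neighbourhood of
      -- `v` nor are adjacent to it.
      paint≢τ : ∀ {x u} (a : Zone u) i → x ≡ v ⊎ E G v x → E G x u ⊎ x ≡ u → τ t ≢ paint t a i
      paint≢τ (centre _)         i _ _ eq = τ≢β _ _ eq
      paint≢τ (near _)           i _ _ eq = τ≢β _ _ eq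
      paint≢τ (second _ _ _ _ _) i _ _ eq = τ≢β _ _ eq
      paint≢τ (far u≢v _ _)   i (inj₁ refl) (inj₂ refl) _ = u≢v refl
      paint≢τ (far _ ¬vu _)   i (inj₁ refl) (inj₁ e)    _ = ¬vu e
      paint≢τ (far _ ¬vu _)   i (inj₂ vx)   (inj₂ refl) _ = ¬vu vx
      paint≢τ (far _ _ none)  i (inj₂ vx)   (inj₁ e)    _ = none _ vx e

      ψ-adj-μ : E (Exp c (Blowup G q)) (simple ψ) (μ t)
      ψ-adj-μ (x , i) (y , j) e with inner x
      ... | no _  = paint≢τ′ (zone y) j
      ... | yes h = paint≢τ (zone y) j h ([ inj₁ , inj₂ ∘ proj₁ ]′ e)

    impossible : ⊥
    impossible with some-τ
    ... | fzero , e    = proper _ _ (ψ-adj-μ fzero (fsuc fzero) λ ()) (trans (Ψψ fzero (fsuc fzero) λ ()) (sym e))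
    ... | t@(fsuc _) , e = proper _ _ (ψ-adj-μ t fzero λ ()) (trans (Ψψ t fzero λ ()) (sym e))

  contradictory : (∀ v b → Dec (Fragile v b)) → ⊥
  contradictory F? with all? (λ v → suc (q + q) ≤? ∣ select (F? v) ∣)
  ... | yes many = fragile-few (proj₁ ∘ en) (proj₁ ∘ proj₂ ∘ en) λ v b → ∈-select⁻ (F? v) (proj₂ (proj₂ (en v)) b)
    where en = λ v → enumerate (select (F? v)) (suc (q + q)) (many v)
  ... | no ¬many with ¬∀⟶∃¬ p _ (λ v → suc (q + q) ≤? ∣ select (F? v) ∣) ¬many
  -- At most 2q fragile colours at `v` leave at least c - 2q = 2q + 2 robust ones.
  ...   | v , few = Robust.impossible v (proj₁ en) (proj₁ (proj₂ en))
            λ t frag → x∈∁p⇒x∉p (proj₂ (proj₂ en) t) (∈-select⁺ (F? v) frag)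
    where
    A = select (F? v)
    en = enumerate (∁ A) (suc (suc (q + q))) (subst (suc (suc (q + q)) ≤_) (sym (∣∁p∣≡n∸∣p∣ A))
      (≤-trans (≤-reflexive (sym (m+n∸n≡m (suc (suc (q + q))) (q + q)))) (∸-monoʳ-≤ c (≤-pred (≰⇒> few)))))

shitov : ∀ {p q} (G : Graph (Fin p)) → Loopless G → ¬ HasCycle G 3 → ¬ HasCycle G 5 →
  p * (p * p) < suc (q + q) →
  (Ψ : (Fin p × Fin q → Fin (suc (κ q))) → Fin (suc (κ q))) →
  (∀ φ ψ → E (Exp (suc (κ q)) (Blowup G q)) φ ψ → Ψ φ ≢ Ψ ψ) →
  ¬ (∀ φ → ∃ λ x → Ψ φ ≡ φ x)
shitov G loopless no-C₃ no-C₅ p³≤2q Ψ proper range =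
  ¬¬-∀-Fin (λ x → ¬¬-∀-Fin λ y → ¬¬-excluded-middle) λ E? →
  ¬¬-∀-Fin (λ v → ¬¬-∀-Fin λ b → ¬¬-excluded-middle)
    (Shitov.contradictory G loopless no-C₃ no-C₅ p³≤2q Ψ proper range E?)

-- Chromatic numbers of the blow-up and its exponential graph

ChromGe-mono : ∀ {V} (G : Graph V) {m n} → m ≤ n → ChromGe G n → ChromGe G m
ChromGe-mono G m≤n χ k col = ≤-trans m≤n (χ k col)

Pullback : ∀ {V W} → (W → V) → Graph V → Graph W
Pullback f G = record { E = λ x y → E G (f x) (f y) ; E-sym = E-sym G }

ChromGe-Pullback : ∀ {V W} {G : Graph V} (f : W → V) (g : V → W) → (∀ x → f (g x) ≡ x) →
  ∀ {n} → ChromGe G n → ChromGe (Pullback f G) n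
ChromGe-Pullback {G = G} f g fg χ k (col , proper) =
  χ k (col ∘ g , λ x y e → proper (g x) (g y) (subst₂ (E G) (sym (fg x)) (sym (fg y)) e))

ChromGe-Exp-Pullback : ∀ {V W} {G : Graph V} (f : W → V) {m n} →
  ChromGe (Exp m G) n → ChromGe (Exp m (Pullback f G)) n
ChromGe-Exp-Pullback f χ k (col , proper) =
  χ k ((λ φ → col (φ ∘ f)) , λ φ ψ adj → proper (φ ∘ f) (ψ ∘ f) λ x y → adj (f x) (f y))

-- The evaluation map of El-Zahar and Sauer colours the product of `H` and its exponential graph
-- with `m` colours. A loop in the latter would be an `m`-colouring of `H`.
poljak-rödl : ∀ {a} (H : Graph (Fin a)) {m n} → Loopless H → ChromGe H (suc m) →
  ChromGe H n → ChromGe (Exp m H) n → PoljakRodlLe n m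
poljak-rödl {a} H {m} {n} loopless m<χ χH χExp =
  a , m ^ a , H , Pullback finToFun (Exp m H) , loopless
  , (λ b loop → <-irrefl refl (m<χ m (finToFun b , loop)))
  , χH
  , (λ k (col , proper) → χExp k (col ∘ funToFin , λ φ ψ adj → proper (funToFin φ) (funToFin ψ)
      λ x y e eq → adj x y e (trans (sym (finToFun-funToFin φ x)) (trans eq (finToFun-funToFin ψ y)))))
  , (λ { (x , b) → finToFun {m} {a} b x }) , λ { (x , b) (y , b′) (e , adj) → adj x y e }

Blowup-loopless : ∀ {V} (G : Graph V) q → Loopless G → Loopless (Blowup G q)
Blowup-loopless G q loopless (x , i) (inj₁ e)           = loopless x e
Blowup-loopless G q loopless (x , i) (inj₂ (_ , i≢i)) = i≢i refl

Blowup⇒ABColouring : ∀ {V} (G : Graph V) {q k} → Colouring (Blowup G q) k → ABColouring G k q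
Blowup⇒ABColouring G {q} {k} (col , proper) =
  (λ x → image (λ i → col (x , i)))
  , (λ x → ∣image∣ _ λ {i} {j} → inj x i j)
  , disjoint
  where
  inj : ∀ x i j → col (x , i) ≡ col (x , j) → i ≡ j
  inj x i j e with i ≟ j
  ... | yes i≡j = i≡j
  ... | no  i≢j = ⊥-elim (proper _ _ (inj₂ (refl , i≢j)) e)
  disjoint : ∀ x y → E G x y → ∀ a → ¬ (a ∈ image (λ i → col (x , i)) × a ∈ image (λ i → col (y , i)))
  disjoint x y e a (ax , ay) with ∈-image⁻ (λ i → col (x , i)) ax | ∈-image⁻ (λ i → col (y , i)) ay
  ... | i , ei | j , ej = proper _ _ (inj₁ e) (trans ei (sym ej))

constants-injective : ∀ {V} (H : Graph V) {m k} ((Ψ , _) : Colouring (Exp m H) k) →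
  Injective _≡_ _≡_ (λ (i : Fin m) → Ψ (const i))
constants-injective H (Ψ , proper) {i} {j} e with i ≟ j
... | yes i≡j = i≡j
... | no  i≢j = ⊥-elim (proper (const i) (const j) (λ _ _ _ → i≢j) e)

module _ {p q : ℕ} (G : Graph (Fin p)) (loopless : Loopless G)
  (no-C₃ : ¬ HasCycle G 3) (no-C₅ : ¬ HasCycle G 5) (p³≤2q : p * (p * p) < suc (q + q)) where

  private
    H : Graph (Fin p × Fin q)
    H = Blowup G q
    k : ℕ
    k = κ q

  Exp-uncolourable : ∀ {m r} → k + k + suc r < m → ¬ Colouring (Exp m H) (m + suc r)
  Exp-uncolourable {m} {r} 2k+r<m (Ψ , proper) =
    ¬¬-∀-Subset choose λ sel → lovász-kneser (proj₁ ∘ sel)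
      (λ A B cA cB → distinct (proj₂ (sel A) cA) (proj₂ (sel B) cB)) 2k+r<m
    where
    ι : Fin m → Fin (m + suc r)
    ι i = Ψ (const i)

    rank = co-rank ι (constants-injective H (Ψ , proper))

    Secondary : Subset m → Fin (suc r) → Set
    Secondary A j = ∃ λ φ → (∀ x → φ x ∈ A) × Σ (∀ i → ι i ≢ Ψ φ) λ s → proj₁ rank (Ψ φ) s ≡ j

    distinct : ∀ {A B i j} → Secondary A i → Secondary B j → Disjoint A B → i ≢ j
    distinct (φ , φ∈A , s , refl) (ψ , ψ∈B , s′ , refl) A∩B≡∅ e = proper φ ψ
      (λ x y _ eq → A∩B≡∅ (φ x) (φ∈A x , subst (_∈ _) (sym eq) (ψ∈B y)))
      (proj₂ rank _ _ s s′ e)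

    choose : ∀ A → ¬ ¬ ∃ λ j → suc k ≤ ∣ A ∣ → Secondary A j
    choose A none with suc k ≤? ∣ A ∣
    -- Small sets get an arbitrary colour, which exists because there are `suc r` secondary ones.
    ... | no  ¬large = none (fzero , λ large → ⊥-elim (¬large large))
    ... | yes large with enumerate A (suc k) large
    ...   | α , α-inj , α∈A = shitov G loopless no-C₃ no-C₅ p³≤2q Ψ′ proper′ λ φ → _ , refl
      where
      primary : ∀ φ → ∃ λ x → ι (α (φ x)) ≡ Ψ (α ∘ φ)
      primary φ with any? (λ i → ι i ≟ Ψ (α ∘ φ))
      ... | no secondary = ⊥-elim (none (_ , λ _ → α ∘ φ , (λ x → α∈A (φ x)) , (λ i e → secondary (i , e)) , refl))
      ... | yes (i , e) with any? (λ x → any? λ y → α (φ (x , y)) ≟ i)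
      ...   | yes (x , y , refl) = (x , y) , e
      -- A map that misses the value `i` is adjacent to `const i`, so it cannot share its colour.
      ...   | no unused = ⊥-elim (proper (const i) (α ∘ φ) (λ { _ (x , y) _ eq → unused (x , y , sym eq) }) e)

      -- Reading each primary colour back through `ι` and `α` colours every map by one of its own
      -- values, the situation that `shitov` excludes.
      Ψ′ : (Fin p × Fin q → Fin (suc k)) → Fin (suc k)
      Ψ′ φ = φ (proj₁ (primary φ))

      proper′ : ∀ φ ψ → E (Exp (suc k) H) φ ψ → Ψ′ φ ≢ Ψ′ ψ
      proper′ φ ψ adj e = proper (α ∘ φ) (α ∘ ψ) (λ x y xy → adj x y xy ∘ α-inj)
        (trans (sym (proj₂ (primary φ))) (trans (cong (ι ∘ α) e) (proj₂ (primary ψ))))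

  ChromGe-Exp : ∀ d → 1 ≤ d → ChromGe (Exp (d * suc k) H) (2 * d * suc k ∸ 2 * suc k + 2)
  -- For d = 1 the target is 2, and two constant maps already need two colours.
  ChromGe-Exp (suc zero) _ n col = ≤-trans (≤-reflexive (cong (_+ 2) (n∸n≡0 (2 * suc k))))
    (≤-trans (s≤s (s≤s z≤n)) (injective⇒≤ (constants-injective H col)))
  ChromGe-Exp (suc (suc e)) _ n (Ψ , proper) with 2 * suc (suc e) * suc k ∸ 2 * suc k + 2 ≤? n
  ... | yes le = le
  -- Here m = (e + 2)c, and one colour below the target is m + ec + 1, leaving ec + 1 secondary
  -- colours. The Kneser bound is then exceeded by exactly one.
  ... | no ¬le = ⊥-elim (Exp-uncolourable {r = e * suc k} (≤-reflexive (lhs e k))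
      ((λ φ → inject≤ (Ψ φ) n≤) , λ φ ψ adj eq → proper φ ψ adj (inject≤-injective n≤ n≤ _ _ eq)))
    where
    lhs : ∀ e k → suc (k + k + suc (e * suc k)) ≡ suc (suc e) * suc k
    lhs = solve-∀
    expand : ∀ e k → 2 * suc (suc e) * suc k ≡ 2 * suc k + (2 * suc k + 2 * (e * suc k))
    expand = solve-∀
    total : ∀ e k → (2 * suc k + 2 * (e * suc k)) + 2 ≡ suc (suc (suc e) * suc k + suc (e * suc k))
    total = solve-∀
    bound : 2 * suc (suc e) * suc k ∸ 2 * suc k + 2 ≡ suc (suc (suc e) * suc k + suc (e * suc k))
    bound = trans (cong (_+ 2) (trans (cong (_∸ 2 * suc k) (expand e k)) (m+n∸m≡n (2 * suc k) _))) (total e k)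
    n≤ : n ≤ suc (suc e) * suc k + suc (e * suc k)
    n≤ = ≤-pred (subst (n <_) bound (≰⇒> ¬le))

-- Numerical bounds and the final assembly.

n≤2*2^[n∸1] : ∀ n → n ≤ 2 * 2 ^ (n ∸ 1)
n≤2*2^[n∸1] zero          = z≤n
n≤2*2^[n∸1] (suc zero)    = s≤s z≤n
n≤2*2^[n∸1] (suc (suc n)) = +-mono-≤ (m^n>0 2 (suc n))
  (≤-trans (n≤2*2^[n∸1] (suc n)) (≤-reflexive (sym (+-identityʳ (2 ^ suc n)))))

cube-bound : ∀ p q → 2 ^ (p ∸ 1) * p ^ 2 ≤ q → p * (p * p) < suc (q + q)
cube-bound p q h = s≤s (begin
  p * (p * p)                           ≤⟨ *-monoˡ-≤ (p * p) (n≤2*2^[n∸1] p) ⟩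
  2 * 2 ^ (p ∸ 1) * (p * p)             ≡⟨ regroup p (2 ^ (p ∸ 1)) ⟩
  2 ^ (p ∸ 1) * p ^ 2 + 2 ^ (p ∸ 1) * p ^ 2 ≤⟨ +-mono-≤ h h ⟩
  q + q                                 ∎)
  where
  open ≤-Reasoning
  regroup : ∀ p x → 2 * x * (p * p) ≡ x * (p * (p * 1)) + x * (p * (p * 1))
  regroup = solve-∀

q≥40 : ∀ {p q} → 6 ≤ p → 2 ^ (p ∸ 1) * p ^ 2 ≤ q → 40 ≤ q
-- The summands give 1152 = 2^5 * 6^2, the value of the lower bound at p = 6.
q≥40 {p} 6≤p h = ≤-trans (m≤m+n 40 1112)
  (≤-trans (*-mono-≤ (^-monoʳ-≤ 2 (∸-monoˡ-≤ 1 6≤p)) (^-monoˡ-≤ 2 6≤p)) h)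

-- The fractional bound gives at least 8.1dq colours, and the surplus 0.1dq over 8dq covers the
-- missing 4d once q is at least 40.
Blowup-chrom : ∀ {V} (G : Graph V) d {q} → FracChromGe G (81 * d) 10 → 40 ≤ q →
  ChromGe (Blowup G q) (2 * (d * (4 * q + 2)))
Blowup-chrom G d {q} χf 40≤q k col = *-cancelˡ-≤ 10 (begin
  10 * (2 * (d * (4 * q + 2))) ≡⟨ expand d q ⟩
  80 * (d * q) + d * 40        ≤⟨ +-mono-≤ ≤-refl (*-monoʳ-≤ d 40≤q) ⟩
  80 * (d * q) + d * q         ≡⟨ collect d q ⟩
  81 * d * q                   ≤⟨ χf k q (≤-trans (s≤s z≤n) 40≤q) (Blowup⇒ABColouring G col) ⟩
  10 * k                       ∎)
  where
  open ≤-Reasoning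
  expand : ∀ d q → 10 * (2 * (d * (4 * q + 2))) ≡ 80 * (d * q) + d * 40
  expand = solve-∀
  collect : ∀ d q → 80 * (d * q) + d * q ≡ 81 * d * q
  collect = solve-∀

target≤2m : ∀ d c → 1 ≤ d → 2 ≤ c → 2 * d * c ∸ 2 * c + 2 ≤ 2 * (d * c)
target≤2m (suc d) c _ 2≤c = begin
  2 * suc d * c ∸ 2 * c + 2           ≡⟨ cong (λ x → x ∸ 2 * c + 2) (expand d c) ⟩
  2 * c + 2 * (d * c) ∸ 2 * c + 2     ≡⟨ cong (_+ 2) (m+n∸m≡n (2 * c) _) ⟩
  2 * (d * c) + 2                     ≤⟨ +-mono-≤ (≤-refl {2 * (d * c)}) (≤-trans 2≤c (m≤m+n c (c + 0))) ⟩
  2 * (d * c) + 2 * c                 ≡⟨ collect d c ⟩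
  2 * (suc d * c)                     ∎
  where
  open ≤-Reasoning
  expand : ∀ d c → 2 * suc d * c ≡ 2 * c + 2 * (d * c)
  expand = solve-∀
  collect : ∀ d c → 2 * (d * c) + 2 * c ≡ 2 * (suc d * c)
  collect = solve-∀

theorem2 : (d p q : ℕ) (G : Graph (Fin p)) → 1 ≤ d → Loopless G → Girth G 6
    → FracChromGe G (81 * d) 10 → 2 ^ (p ∸ 1) * p ^ 2 ≤ q
    → ChromGe (Blowup G q) (2 * d * (4 * q + 2) ∸ 2 * (4 * q + 2) + 2)
    × ChromGe (Exp (d * (4 * q + 2)) (Blowup G q)) (2 * d * (4 * q + 2) ∸ 2 * (4 * q + 2) + 2)
    × PoljakRodlLe (2 * d * (4 * q + 2) ∸ 2 * (4 * q + 2) + 2) (d * (4 * q + 2))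
theorem2 d p q G 1≤d loopless ((_ , cycle-inj , _) , no-short) χf q-large = χH , χExp , f≤
  where
  c m n : ℕ
  c = 4 * q + 2
  m = d * c
  n = 2 * d * c ∸ 2 * c + 2

  H : Graph (Fin p × Fin q)
  H = Blowup G q

  2≤c : 2 ≤ c
  2≤c = m≤n+m 2 (4 * q)

  χH-2m : ChromGe H (2 * m)
  -- The six distinct vertices of a shortest cycle give p at least 6.
  χH-2m = Blowup-chrom G d χf (q≥40 (injective⇒≤ cycle-inj) q-large)

  χH : ChromGe H n
  χH = ChromGe-mono H (target≤2m d c 1≤d 2≤c) χH-2m

  χExp : ChromGe (Exp m H) n
  χExp = subst (λ c → ChromGe (Exp (d * c) H) (2 * d * c ∸ 2 * c + 2)) (unfold q)
    (ChromGe-Exp G loopless (no-short 3 ≤-refl (m≤m+n 4 2)) (no-short 5 (m≤m+n 3 2) ≤-refl)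
      (cube-bound p q q-large) d 1≤d)
    where
    unfold : ∀ q → suc (suc (q + q)) + (q + q) ≡ 4 * q + 2
    unfold = solve-∀

  -- The target `n` need not exceed `m` (it is 2 for d = 1), so looplessness of the exponential
  -- graph rests on the stronger bound `2 * m`.
  m<2m : suc m ≤ 2 * m
  m<2m = ≤-trans (+-mono-≤ (*-mono-≤ 1≤d (≤-trans (s≤s z≤n) 2≤c)) (≤-refl {m})) (+-mono-≤ (≤-refl {m}) (m≤m+n m 0))

  index : Fin (p * q) → Fin p × Fin q
  index = remQuot {p} q

  χPull : ∀ {k} → ChromGe H k → ChromGe (Pullback index H) k
  χPull = ChromGe-Pullback {G = H} index (λ (x , i) → combine x i) λ (x , i) → remQuot-combine x i

  f≤ : PoljakRodlLe n m
  f≤ = poljak-rödl (Pullback index H) (λ x → Blowup-loopless G q loopless (index x))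
    (χPull (ChromGe-mono H m<2m χH-2m)) (χPull χH) (ChromGe-Exp-Pullback {G = H} index χExp)
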